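{- Fix any $0<\alpha<1$, let $d=\lfloor n^\alpha\rfloor$ and let $\varepsilon=\Theta(1/d)$. Then, for all sufficiently large $n$ with $dn$ even, there exists a connected $d$-regular graph on $n$ vertices for which the stationary probability of any given vertex can be boosted by the $\varepsilon$-biased random walk from $1/n$ to $\Omega(1/n^\alpha)$; that is, for every vertex $v$ there is an unchanging strategy for the $\varepsilon$-biased random walk under which the stationary probability of $v$ is $\Omega(n^{ -\alpha})$ (with implied constant depending only on $\alpha$ and on the constants implicit in $\varepsilon=\Theta(1/d)$).
   Context: Asymptotic notation is as $n\to\infty$. Let $\mathbf P$ be the transition matrix of the simple random walk on a connected graph $G$ (move to a uniformly random neighbour); on an $n$-vertex regular graph its stationary distribution is uniform. An unchanging strategy for the $\varepsilon$-biased random walk is a Markov chain with transition matrix $\mathbf Q=(1-\varepsilon)\mathbf P+\varepsilon\mathbf B$, where $\mathbf B$ is an arbitrary stochastic matrix, chosen by a controller, supported on the edges of $G$; the stationary probability of a vertex under the strategy is its probability in the stationary distribution of $\mathbf Q$. -}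

module Defs where

open import Data.Bool.Base using (Bool; T; false; if_then_else_)
open import Data.Fin.Base using (Fin)
open import Data.Fin.Subset using (Subset; ∣_∣)
open import Data.Integer.Base using (+_)
open import Data.Nat.Base as ℕ using (ℕ; zero; suc; _⊔_)
import Data.Nat.Properties as ℕₚ
open import Data.Product.Base using (∃-syntax; _×_; _,_)
open import Data.Rational.Base as ℚ using (ℚ; 0ℚ; 1ℚ; ½)
import Data.Rational.Properties as ℚₚ
import Algebra.Properties.CommutativeSemigroup as CommutativeSemigroupProperties
open import Data.Vec.Base using (tabulate)
open import Algebra.Bundles using (CommutativeMonoid)
open import Algebra.Bundles.Raw using (RawRing)
import Algebra.Definitions.RawMonoid as RawMonoidDefinitions
import Algebra.Definitions.RawSemiring as RawSemiringDefinitions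
open import Level using (0ℓ)
open import Relation.Binary.Construct.Closure.ReflexiveTransitive using (Star)
open import Relation.Binary.PropositionalEquality

open CommutativeSemigroupProperties
  (CommutativeMonoid.commutativeSemigroup ℚₚ.+-0-commutativeMonoid) using (interchange)

-- Real numbers are Cauchy sequences of rationals, with equality _≈_.

IsCauchy : (ℕ → ℚ) → Set
IsCauchy s = ∀ δ → 0ℚ ℚ.< δ →
  ∃[ N ] (∀ m n → N ℕ.≤ m → N ℕ.≤ n → ℚ.∣ s m ℚ.- s n ∣ ℚ.< δ)

record ℝ : Set where
  constructor mkℝ
  field
    seq    : ℕ → ℚ
    cauchy : IsCauchy seq

open ℝ public

infix 4 _≈_ _≤_ _<_

_≈_ : ℝ → ℝ → Set
x ≈ y = ∀ δ → 0ℚ ℚ.< δ →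
  ∃[ N ] (∀ n → N ℕ.≤ n → ℚ.∣ seq x n ℚ.- seq y n ∣ ℚ.< δ)

_≤_ : ℝ → ℝ → Set
x ≤ y = ∀ δ → 0ℚ ℚ.< δ →
  ∃[ N ] (∀ n → N ℕ.≤ n → seq x n ℚ.≤ seq y n ℚ.+ δ)

_<_ : ℝ → ℝ → Set
x < y = ∃[ δ ] (0ℚ ℚ.< δ ×
  ∃[ N ] (∀ n → N ℕ.≤ n → seq x n ℚ.+ δ ℚ.≤ seq y n))

fromℚ : ℚ → ℝ
fromℚ q = mkℝ (λ _ → q) λ δ 0<δ → 0 , λ _ _ _ _ →
  subst (λ z → ℚ.∣ z ∣ ℚ.< δ) (sym (ℚₚ.+-inverseʳ q)) 0<δ

fromℕ : ℕ → ℝ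
fromℕ n = fromℚ (+ n ℚ./ 1)

0ℝ 1ℝ : ℝ
0ℝ = fromℚ 0ℚ
1ℝ = fromℚ 1ℚ

private
  ½δ : ∀ {δ} → 0ℚ ℚ.< δ → 0ℚ ℚ.< ½ ℚ.* δ
  ½δ {δ} 0<δ = subst (ℚ._< ½ ℚ.* δ) (ℚₚ.*-zeroʳ ½) (ℚₚ.*-monoʳ-<-pos ½ 0<δ)

  halves : ∀ δ → ½ ℚ.* δ ℚ.+ ½ ℚ.* δ ≡ δ
  halves δ = trans (sym (ℚₚ.*-distribʳ-+ δ ½ ½)) (ℚₚ.*-identityˡ δ)

  cancel : ∀ a b → (a ℚ.- b) ℚ.+ b ≡ a
  cancel a b = trans (ℚₚ.+-assoc a (ℚ.- b) b)
    (trans (cong (a ℚ.+_) (ℚₚ.+-inverseˡ b)) (ℚₚ.+-identityʳ a))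

  telescope : ∀ a b c → (a ℚ.- b) ℚ.+ (b ℚ.- c) ≡ a ℚ.- c
  telescope a b c = trans (sym (ℚₚ.+-assoc (a ℚ.- b) b (ℚ.- c)))
    (cong (ℚ._- c) (cancel a b))

  +-diff : ∀ a b c d → (a ℚ.+ b) ℚ.- (c ℚ.+ d) ≡ (a ℚ.- c) ℚ.+ (b ℚ.- d)
  +-diff a b c d = trans (cong (a ℚ.+ b ℚ.+_) (ℚₚ.neg-distrib-+ c d))
    (interchange a b (ℚ.- c) (ℚ.- d))

  *-distribˡ-- : ∀ a b c → a ℚ.* (b ℚ.- c) ≡ a ℚ.* b ℚ.- a ℚ.* c
  *-distribˡ-- a b c = trans (ℚₚ.*-distribˡ-+ a b (ℚ.- c))
    (cong (a ℚ.* b ℚ.+_) (sym (ℚₚ.neg-distribʳ-* a c)))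

  *-diff : ∀ a b c d → a ℚ.* b ℚ.- c ℚ.* d ≡ a ℚ.* (b ℚ.- d) ℚ.+ d ℚ.* (a ℚ.- c)
  *-diff a b c d = sym (begin
    a ℚ.* (b ℚ.- d) ℚ.+ d ℚ.* (a ℚ.- c)
      ≡⟨ cong₂ ℚ._+_ (*-distribˡ-- a b d) (*-distribˡ-- d a c) ⟩
    (a ℚ.* b ℚ.- a ℚ.* d) ℚ.+ (d ℚ.* a ℚ.- d ℚ.* c)
      ≡⟨ cong ((a ℚ.* b ℚ.- a ℚ.* d) ℚ.+_)
           (cong₂ ℚ._-_ (ℚₚ.*-comm d a) (ℚₚ.*-comm d c)) ⟩
    (a ℚ.* b ℚ.- a ℚ.* d) ℚ.+ (a ℚ.* d ℚ.- c ℚ.* d)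
      ≡⟨ telescope (a ℚ.* b) (a ℚ.* d) (c ℚ.* d) ⟩
    a ℚ.* b ℚ.- c ℚ.* d ∎)
    where
    open ≡-Reasoning

  +-cauchy : ∀ {s t} → IsCauchy s → IsCauchy t → IsCauchy (λ n → s n ℚ.+ t n)
  +-cauchy {s} {t} cs ct δ 0<δ with cs (½ ℚ.* δ) (½δ 0<δ) | ct (½ ℚ.* δ) (½δ 0<δ)
  ... | M , p | N , q = M ⊔ N , λ m n k≤m k≤n → begin-strict
    ℚ.∣ (s m ℚ.+ t m) ℚ.- (s n ℚ.+ t n) ∣
      ≡⟨ cong ℚ.∣_∣ (+-diff (s m) (t m) (s n) (t n)) ⟩
    ℚ.∣ (s m ℚ.- s n) ℚ.+ (t m ℚ.- t n) ∣
      ≤⟨ ℚₚ.∣p+q∣≤∣p∣+∣q∣ (s m ℚ.- s n) (t m ℚ.- t n) ⟩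
    ℚ.∣ s m ℚ.- s n ∣ ℚ.+ ℚ.∣ t m ℚ.- t n ∣
      <⟨ ℚₚ.+-mono-< (p m n (ℕₚ.m⊔n≤o⇒m≤o M N k≤m) (ℕₚ.m⊔n≤o⇒m≤o M N k≤n))
                     (q m n (ℕₚ.m⊔n≤o⇒n≤o M N k≤m) (ℕₚ.m⊔n≤o⇒n≤o M N k≤n)) ⟩
    ½ ℚ.* δ ℚ.+ ½ ℚ.* δ
      ≡⟨ halves δ ⟩
    δ ∎
    where
    open ℚₚ.≤-Reasoning

  neg-cauchy : ∀ {s} → IsCauchy s → IsCauchy (λ n → ℚ.- s n)
  neg-cauchy {s} cs δ 0<δ with cs δ 0<δ
  ... | N , p = N , λ m n N≤m N≤n →
    subst (ℚ._< δ)
      (trans (sym (ℚₚ.∣-p∣≡∣p∣ (s m ℚ.- s n)))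
             (cong ℚ.∣_∣ (ℚₚ.neg-distrib-+ (s m) (ℚ.- s n))))
      (p m n N≤m N≤n)

  0<1 : 0ℚ ℚ.< 1ℚ
  0<1 = ℚₚ.positive⁻¹ 1ℚ

  bounded : ∀ {s} → IsCauchy s →
            ∃[ K ] (0ℚ ℚ.< K × ∃[ N ] (∀ n → N ℕ.≤ n → ℚ.∣ s n ∣ ℚ.≤ K))
  bounded {s} cs with cs 1ℚ 0<1
  ... | N , p = 1ℚ ℚ.+ ℚ.∣ s N ∣
              , ℚₚ.+-mono-<-≤ 0<1 (ℚₚ.0≤∣p∣ (s N))
              , N , λ n N≤n → begin
    ℚ.∣ s n ∣
      ≡⟨ cong ℚ.∣_∣ (sym (cancel (s n) (s N))) ⟩
    ℚ.∣ (s n ℚ.- s N) ℚ.+ s N ∣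
      ≤⟨ ℚₚ.∣p+q∣≤∣p∣+∣q∣ (s n ℚ.- s N) (s N) ⟩
    ℚ.∣ s n ℚ.- s N ∣ ℚ.+ ℚ.∣ s N ∣
      ≤⟨ ℚₚ.+-monoˡ-≤ ℚ.∣ s N ∣ (ℚₚ.<⇒≤ (p n N N≤n ℕₚ.≤-refl)) ⟩
    1ℚ ℚ.+ ℚ.∣ s N ∣ ∎
    where
    open ℚₚ.≤-Reasoning

  divide : ∀ K δ → 0ℚ ℚ.< K → 0ℚ ℚ.< δ → ∃[ η ] (0ℚ ℚ.< η × K ℚ.* η ≡ δ)
  divide K δ 0<K 0<δ = K⁻¹ ℚ.* δ
    , subst (ℚ._< K⁻¹ ℚ.* δ) (ℚₚ.*-zeroʳ K⁻¹) (ℚₚ.*-monoʳ-<-pos K⁻¹ {{pos}} 0<δ)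
    , trans (sym (ℚₚ.*-assoc K K⁻¹ δ))
        (trans (cong (ℚ._* δ) (ℚₚ.*-inverseʳ K {{nonZero}})) (ℚₚ.*-identityˡ δ))
    where
    nonZero = ℚₚ.pos⇒nonZero K {{ℚ.positive 0<K}}
    K⁻¹ = (ℚ.1/ K) {{nonZero}}
    pos = ℚₚ.1/pos⇒pos K {{ℚ.positive 0<K}}

  *-bound : ∀ a b c η → 0ℚ ℚ.< c → ℚ.∣ a ∣ ℚ.≤ c → ℚ.∣ b ∣ ℚ.< η →
            ℚ.∣ a ℚ.* b ∣ ℚ.< c ℚ.* η
  *-bound a b c η 0<c a≤c b<η = begin-strict
    ℚ.∣ a ℚ.* b ∣
      ≡⟨ ℚₚ.∣p*q∣≡∣p∣*∣q∣ a b ⟩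
    ℚ.∣ a ∣ ℚ.* ℚ.∣ b ∣
      ≤⟨ ℚₚ.*-monoʳ-≤-nonNeg ℚ.∣ b ∣ {{ℚₚ.∣-∣-nonNeg b}} a≤c ⟩
    c ℚ.* ℚ.∣ b ∣
      <⟨ ℚₚ.*-monoʳ-<-pos c {{ℚ.positive 0<c}} b<η ⟩
    c ℚ.* η ∎
    where
    open ℚₚ.≤-Reasoning

  *-estimate : ∀ a b c d K L η → 0ℚ ℚ.< K → 0ℚ ℚ.< L →
    ℚ.∣ a ∣ ℚ.≤ K → ℚ.∣ d ∣ ℚ.≤ L → ℚ.∣ a ℚ.- c ∣ ℚ.< η → ℚ.∣ b ℚ.- d ∣ ℚ.< η →
    ℚ.∣ a ℚ.* b ℚ.- c ℚ.* d ∣ ℚ.< (K ℚ.+ L) ℚ.* η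
  *-estimate a b c d K L η 0<K 0<L a≤K d≤L a-c<η b-d<η = begin-strict
    ℚ.∣ a ℚ.* b ℚ.- c ℚ.* d ∣
      ≡⟨ cong ℚ.∣_∣ (*-diff a b c d) ⟩
    ℚ.∣ a ℚ.* (b ℚ.- d) ℚ.+ d ℚ.* (a ℚ.- c) ∣
      ≤⟨ ℚₚ.∣p+q∣≤∣p∣+∣q∣ (a ℚ.* (b ℚ.- d)) (d ℚ.* (a ℚ.- c)) ⟩
    ℚ.∣ a ℚ.* (b ℚ.- d) ∣ ℚ.+ ℚ.∣ d ℚ.* (a ℚ.- c) ∣
      <⟨ ℚₚ.+-mono-< (*-bound a (b ℚ.- d) K η 0<K a≤K b-d<η)
                     (*-bound d (a ℚ.- c) L η 0<L d≤L a-c<η) ⟩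
    K ℚ.* η ℚ.+ L ℚ.* η
      ≡⟨ ℚₚ.*-distribʳ-+ η K L ⟨
    (K ℚ.+ L) ℚ.* η ∎
    where
    open ℚₚ.≤-Reasoning

  *-cauchy : ∀ {s t} → IsCauchy s → IsCauchy t → IsCauchy (λ n → s n ℚ.* t n)
  *-cauchy {s} {t} cs ct δ 0<δ with bounded cs | bounded ct
  ... | K , 0<K , M , p | L , 0<L , N , q
    with divide (K ℚ.+ L) δ (ℚₚ.+-mono-< 0<K 0<L) 0<δ
  ... | η , 0<η , KLη≡δ with cs η 0<η | ct η 0<η
  ... | M′ , p′ | N′ , q′ = (M ⊔ N) ⊔ (M′ ⊔ N′) , λ m n o≤m o≤n →
    let l≤m = ℕₚ.m⊔n≤o⇒m≤o (M ⊔ N) (M′ ⊔ N′) o≤m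
        l≤n = ℕₚ.m⊔n≤o⇒m≤o (M ⊔ N) (M′ ⊔ N′) o≤n
        r≤m = ℕₚ.m⊔n≤o⇒n≤o (M ⊔ N) (M′ ⊔ N′) o≤m
        r≤n = ℕₚ.m⊔n≤o⇒n≤o (M ⊔ N) (M′ ⊔ N′) o≤n
    in subst (ℚ.∣ s m ℚ.* t m ℚ.- s n ℚ.* t n ∣ ℚ.<_) KLη≡δ
         (*-estimate (s m) (t m) (s n) (t n) K L η 0<K 0<L
           (p m (ℕₚ.m⊔n≤o⇒m≤o M N l≤m))
           (q n (ℕₚ.m⊔n≤o⇒n≤o M N l≤n))
           (p′ m n (ℕₚ.m⊔n≤o⇒m≤o M′ N′ r≤m) (ℕₚ.m⊔n≤o⇒m≤o M′ N′ r≤n))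
           (q′ m n (ℕₚ.m⊔n≤o⇒n≤o M′ N′ r≤m) (ℕₚ.m⊔n≤o⇒n≤o M′ N′ r≤n)))

infixl 6 _+_ _-_
infixl 7 _*_
infix  8 -_

_+_ : ℝ → ℝ → ℝ
x + y = mkℝ (λ n → seq x n ℚ.+ seq y n) (+-cauchy {seq x} {seq y} (cauchy x) (cauchy y))

-_ : ℝ → ℝ
- x = mkℝ (λ n → ℚ.- seq x n) (neg-cauchy {seq x} (cauchy x))

_-_ : ℝ → ℝ → ℝ
x - y = x + (- y)

_*_ : ℝ → ℝ → ℝ
x * y = mkℝ (λ n → seq x n ℚ.* seq y n) (*-cauchy {seq x} {seq y} (cauchy x) (cauchy y))

ℝ-rawRing : RawRing 0ℓ 0ℓ
ℝ-rawRing = record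
  { Carrier = ℝ ; _≈_ = _≈_ ; _+_ = _+_ ; _*_ = _*_ ; -_ = -_ ; 0# = 0ℝ ; 1# = 1ℝ }

open RawMonoidDefinitions (RawRing.+-rawMonoid ℝ-rawRing) public using (sum)
open RawSemiringDefinitions (RawRing.rawSemiring ℝ-rawRing) public using (_^_)

-- y = n ^ α for a natural number n ≥ 1 and a real α ≥ 0: the unique positive
-- real with n ^ (p / q) ≤ y whenever p / q ≤ α, and y ≤ n ^ (p / q) whenever
-- α ≤ p / q.  Denominators are cleared and q-th roots replaced by q-th powers;
-- the instances with q = 0 hold trivially.
record IsPower (n : ℕ) (α y : ℝ) : Set where
  field
    positive : 0ℝ < y
    lower    : ∀ p q → fromℕ p ≤ fromℕ q * α → fromℕ (n ℕ.^ p) ≤ y ^ q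
    upper    : ∀ p q → fromℕ q * α ≤ fromℕ p → y ^ q ≤ fromℕ (n ℕ.^ p)

IsFloor : ℝ → ℕ → Set
IsFloor y d = fromℕ d ≤ y × y < fromℕ (suc d)

-- The junk value 1/ℕ 0 = 0 is never relevant: it would only be used for the
-- degree of a vertex with a neighbour, or for ⌊ n ^ α ⌋ with n ≥ 1.
1/ℕ_ : ℕ → ℝ
1/ℕ zero    = 0ℝ
1/ℕ (suc k) = fromℚ (+ 1 ℚ./ suc k)

record Graph (n : ℕ) : Set where
  field
    adj         : Fin n → Fin n → Bool
    symmetric   : ∀ u v → adj u v ≡ adj v u
    irreflexive : ∀ v → adj v v ≡ false

  Edge : Fin n → Fin n → Set
  Edge u v = T (adj u v)

  neighbours : Fin n → Subset n
  neighbours v = tabulate (adj v)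

  degree : Fin n → ℕ
  degree v = ∣ neighbours v ∣

  Connected : Set
  Connected = ∀ u v → Star Edge u v

  Regular : ℕ → Set
  Regular d = ∀ v → degree v ≡ d

open Graph public

Matrix : ℕ → Set
Matrix n = Fin n → Fin n → ℝ

IsDistribution : ∀ {n} → (Fin n → ℝ) → Set
IsDistribution π = (∀ i → 0ℝ ≤ π i) × sum π ≈ 1ℝ

IsStochastic : ∀ {n} → Matrix n → Set
IsStochastic M = ∀ i → IsDistribution (M i)

IsStationary : ∀ {n} → Matrix n → (Fin n → ℝ) → Set
IsStationary M π = IsDistribution π × (∀ j → sum (λ i → π i * M i j) ≈ π j)

IsTheStationaryDistribution : ∀ {n} → Matrix n → (Fin n → ℝ) → Set
IsTheStationaryDistribution M π =
  IsStationary M π × (∀ π′ → IsStationary M π′ → ∀ i → π′ i ≈ π i)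

simpleRandomWalk : ∀ {n} → Graph n → Matrix n
simpleRandomWalk G u v = if adj G u v then 1/ℕ degree G u else 0ℝ

SupportedOnEdges : ∀ {n} → Graph n → Matrix n → Set
SupportedOnEdges G B = ∀ u v → adj G u v ≡ false → B u v ≈ 0ℝ

biasedWalk : ∀ {n} → Graph n → ℝ → Matrix n → Matrix n
biasedWalk G ε B u v = (1ℝ - ε) * simpleRandomWalk G u v + ε * B u v

module Submission where

-- The graph is a path of blocks of Θ(d) vertices: copies of K_{d+1}, and a circulant graph that absorbs
-- the remainder of n modulo d + 1.  Consecutive blocks are joined by switching two edges, so that every
-- vertex has at most one neighbour outside its block.
--
-- The strategy for v is a reversible walk: the edges at k blocks from v get conductance (K / (K + 1))ᵏ,
-- with K ≥ 1 / c₁.  At each vertex all edges have the same conductance, except at most one that is larger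
-- by a factor 1 + 1 / K.  Hence every edge is used with probability at least (1 - ε) / d as soon as
-- ε ≥ 1 / (1 + d K), which makes the walk ε-biased.  Its stationary distribution is proportional to the
-- total conductance at a vertex, and by the geometric decay it is spread over O(K d) vertices around v.

open import Algebra.Bundles using (CommutativeRing)
import Algebra.Properties.Semiring.Sum as SemiringSum
open import Data.Bool.Base using (Bool; true; false; T; not; _∧_; _∨_; if_then_else_)
open import Data.Empty using (⊥-elim)
open import Data.Fin.Base as Fin using (Fin; zero; suc; toℕ; fromℕ<; splitAt; _↑ˡ_; _↑ʳ_)
import Data.Integer.Base as ℤ
import Data.Integer.Properties as ℤ
open import Data.Nat.Base as ℕ using (ℕ; zero; suc)
import Data.Nat.Properties as ℕ
import Data.Rational.Unnormalised.Base as ℚᵘ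
open ℚᵘ using (mkℚᵘ)
import Data.Rational.Unnormalised.Properties as ℚᵘ
open import Data.Product.Base using (∃-syntax; _×_; _,_; proj₁; proj₂)
open import Data.Sum.Base using (_⊎_; inj₁; inj₂; [_,_]′)
open import Function.Base using (_∘_)
open import Function.Bundles using (Equivalence; mk⇔)
open import Relation.Binary.PropositionalEquality
open import Relation.Nullary.Decidable using (Dec; does; yes; no; _×-dec_; _⊎-dec_; dec-true; dec-false; does-⇔)
open import Relation.Nullary.Negation using (¬_)

-- A bias of order 1 / d can change the probability of one edge by an amount comparable with the 1 /
-- d that the edge has anyway. It cannot do so for many edges at one vertex. Hence at most one edge
-- per vertex leaves its block, and the conductance drops only by a constant factor per block.
-- Blocks of Θ(d) vertices keep the mass of a level of order d.
--
-- The remaining obstacle is that ε is a Cauchy real while the walk calls for exact algebra. The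
-- walk `Q` is therefore rational and belongs to the fixed bias ε₀ = 1 / (1 + d K), with a
-- controller `B`. For a real ε ≥ ε₀ the controller follows `P` with weight 1 - θ and `B` with
-- weight θ = ε₀ / ε, and the ε-biased walk is `Q` again. Only θ is a genuine real.
--
-- Uniqueness of the stationary distribution concerns arbitrary real vectors, whose approximations
-- satisfy the equations only up to an error. The maximum principle is therefore proved with
-- explicit errors for rational vectors and then applied to the terms of the sequences.

module BlockGraphs where

  open import Defs using (Graph; adj; symmetric; irreflexive; Edge; Connected; Regular; degree)
  open import Data.Bool.Properties using (∧-comm; ∨-comm; T?; T-∧; T-∨)
  open import Data.Fin.Patterns
  open import Data.Fin.Properties using (_≟_; toℕ<n; toℕ-↑ˡ; toℕ-↑ʳ; toℕ-injective; toℕ-fromℕ<; splitAt-↑ˡ; splitAt-↑ʳ; join-splitAt)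
  open import Data.Fin.Subset using (∣_∣)
  open import Data.Nat.Base
  open import Data.Nat.Divisibility using (_∣_; divides; ∣m+n∣m⇒∣n; ∣1⇒≡1; ∣n⇒∣m*n)
  open import Data.Nat.DivMod using (_/_; _%_; m≡m%n+[m/n]*n; m%n<n)
  open import Data.Nat.Primality using (prime[2]; euclidsLemma)
  open import Data.Nat.Properties renaming (_≟_ to _≟ℕ_)
  open import Data.Nat.Solver using (module +-*-Solver)
  open +-*-Solver using (solve; con; _:+_; _:*_; _:=_)
  open import Data.Vec.Base using (tabulate)
  open import Relation.Binary.Construct.Closure.ReflexiveTransitive
    using (Star; ε; _◅_; _◅◅_; gmap; kleisliStar; reverse)
  open SemiringSum +-*-semiring using (sum; sum-cong-≗; ∑-distrib-+; *-distribˡ-sum; *-distribʳ-sum)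

  -- Finite sums of natural numbers, and degrees as sums.

  ⟦_⟧ : Bool → ℕ
  ⟦ b ⟧ = if b then 1 else 0

  sum-mono-≤ : ∀ {n} {f g : Fin n → ℕ} → (∀ i → f i ≤ g i) → sum f ≤ sum g
  sum-mono-≤ {zero}  f≤g = z≤n
  sum-mono-≤ {suc n} f≤g = +-mono-≤ (f≤g zero) (sum-mono-≤ (f≤g ∘ suc))

  term≤sum : ∀ {n} (f : Fin n → ℕ) i → f i ≤ sum f
  term≤sum f zero    = m≤m+n _ _
  term≤sum f (suc i) = m≤n⇒m≤o+n (f zero) (term≤sum (f ∘ suc) i)

  sum-const : ∀ n x → sum {n} (λ _ → x) ≡ n * x
  sum-const zero    x = refl
  sum-const (suc n) x = cong (x +_) (sum-const n x)

  sum-zero : ∀ {n} {f : Fin n → ℕ} → (∀ i → f i ≡ 0) → sum f ≡ 0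
  sum-zero {n} f≡0 = trans (sum-cong-≗ f≡0) (trans (sum-const n 0) (*-zeroʳ n))

  sum-↑ : ∀ m {n} (f : Fin (m + n) → ℕ) → sum f ≡ sum (λ i → f (i ↑ˡ n)) + sum (λ j → f (m ↑ʳ j))
  sum-↑ zero    f = refl
  sum-↑ (suc m) f = trans (cong (f zero +_) (sum-↑ m (f ∘ suc))) (sym (+-assoc (f zero) _ _))

  sum-splitAt : ∀ m {n} (f : Fin m ⊎ Fin n → ℕ) →
    sum (λ i → f (splitAt m i)) ≡ sum (f ∘ inj₁) + sum (f ∘ inj₂)
  sum-splitAt m {n} f = trans (sum-↑ m (f ∘ splitAt m))
    (cong₂ _+_ (sum-cong-≗ λ i → cong f (splitAt-↑ˡ m i n)) (sum-cong-≗ λ j → cong f (splitAt-↑ʳ m n j)))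

  sum-δ : ∀ {n} (a : Fin n) → sum (λ i → ⟦ does (a ≟ i) ⟧) ≡ 1
  sum-δ {suc n} zero    = cong suc (sum-zero {n} λ _ → refl)
  sum-δ {suc n} (suc a) = trans (sum-cong-≗ {n} λ i → refl) (sum-δ a)

  degree≡sum : ∀ {n} (G : Graph n) u → degree G u ≡ sum (λ w → ⟦ adj G u w ⟧)
  degree≡sum G u = count≡sum (adj G u)
    where
    count≡sum : ∀ {n} (f : Fin n → Bool) → ∣ tabulate f ∣ ≡ sum (λ w → ⟦ f w ⟧)
    count≡sum {zero}  f = refl
    count≡sum {suc n} f with f zero
    ... | true  = cong suc (count≡sum (f ∘ suc))
    ... | false = count≡sum (f ∘ suc)

  -- Complete graphs and the switch of two edges.

  complete : ∀ n → Graph n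
  complete n = record
    { adj         = λ u w → not (does (u ≟ w))
    ; symmetric   = λ u w → cong not (≟-sym u w)
    ; irreflexive = λ v → cong not (≟-refl v)
    }
    where
    ≟-refl : ∀ {n} (v : Fin n) → does (v ≟ v) ≡ true
    ≟-refl v with v ≟ v
    ... | yes _   = refl
    ... | no  v≢v = ⊥-elim (v≢v refl)

    ≟-sym : ∀ {n} (u w : Fin n) → does (u ≟ w) ≡ does (w ≟ u)
    ≟-sym u w with u ≟ w | w ≟ u
    ... | yes _   | yes _   = refl
    ... | no  _   | no  _   = refl
    ... | yes u≡w | no  w≢u = ⊥-elim (w≢u (sym u≡w))
    ... | no  u≢w | yes w≡u = ⊥-elim (u≢w (sym w≡u))

  complete-regular : ∀ d → Regular (complete (suc d)) d
  complete-regular d u = trans (degree≡sum (complete (suc d)) u) (suc-injective (begin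
    suc (sum (λ w → ⟦ not (does (u ≟ w)) ⟧))
      ≡⟨ cong (_+ sum (λ w → ⟦ not (does (u ≟ w)) ⟧)) (sum-δ u) ⟨
    sum (λ w → ⟦ does (u ≟ w) ⟧) + sum (λ w → ⟦ not (does (u ≟ w)) ⟧)
      ≡⟨ ∑-distrib-+ (λ w → ⟦ does (u ≟ w) ⟧) (λ w → ⟦ not (does (u ≟ w)) ⟧) ⟨
    sum (λ w → ⟦ does (u ≟ w) ⟧ + ⟦ not (does (u ≟ w)) ⟧)
      ≡⟨ sum-cong-≗ (λ w → excluded-middle (does (u ≟ w))) ⟩
    sum {suc d} (λ _ → 1)
      ≡⟨ sum-const (suc d) 1 ⟩
    suc d * 1
      ≡⟨ *-identityʳ (suc d) ⟩
    suc d ∎))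
    where
    open ≡-Reasoning
    excluded-middle : ∀ b → ⟦ b ⟧ + ⟦ not b ⟧ ≡ 1
    excluded-middle true  = refl
    excluded-middle false = refl

  module _ {n} (a b : Fin n) where

    isPair : Fin n → Fin n → Bool
    isPair u w = does (a ≟ u) ∧ does (b ≟ w) ∨ does (b ≟ u) ∧ does (a ≟ w)

    isPair-sym : ∀ u w → isPair u w ≡ isPair w u
    isPair-sym u w = trans (∨-comm (does (a ≟ u) ∧ does (b ≟ w)) (does (b ≟ u) ∧ does (a ≟ w)))
      (cong₂ _∨_ (∧-comm (does (b ≟ u)) (does (a ≟ w))) (∧-comm (does (a ≟ u)) (does (b ≟ w))))

    isPair⇒≡ : ∀ u w → T (isPair u w) → (a ≡ u × b ≡ w) ⊎ (b ≡ u × a ≡ w)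
    isPair⇒≡ u w t with a ≟ u | b ≟ w | b ≟ u | a ≟ w
    ... | yes p | yes q | _     | _     = inj₁ (p , q)
    ... | yes _ | no  _ | yes r | yes s = inj₂ (r , s)
    ... | no  _ | _     | yes r | yes s = inj₂ (r , s)

  edge≢ : ∀ {n} (G : Graph n) {a b} → Edge G a b → a ≢ b
  edge≢ G {a} ab refl = subst T (irreflexive G a) ab

  edge-sym : ∀ {n} (G : Graph n) {u w} → Edge G u w → Edge G w u
  edge-sym G {u} {w} = subst T (symmetric G u w)

  -- The switch: the edges ab and pq of two disjoint graphs are replaced by ap and bq.
  module Join {m n} (H : Graph m) (G : Graph n) {p q : Fin m} {a b : Fin n}
              (pq : Edge H p q) (ab : Edge G a b) where

    link : Fin m → Fin n → Bool
    link x u = does (p ≟ x) ∧ does (a ≟ u) ∨ does (q ≟ x) ∧ does (b ≟ u)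

    joinAdj : Fin m ⊎ Fin n → Fin m ⊎ Fin n → Bool
    joinAdj (inj₁ x) (inj₁ y) = adj H x y ∧ not (isPair p q x y)
    joinAdj (inj₁ x) (inj₂ u) = link x u
    joinAdj (inj₂ u) (inj₁ x) = link x u
    joinAdj (inj₂ u) (inj₂ w) = adj G u w ∧ not (isPair a b u w)

    private
      joinAdj-sym : ∀ s t → joinAdj s t ≡ joinAdj t s
      joinAdj-sym (inj₁ x) (inj₁ y) = cong₂ (λ c e → c ∧ not e) (symmetric H x y) (isPair-sym p q x y)
      joinAdj-sym (inj₁ x) (inj₂ u) = refl
      joinAdj-sym (inj₂ u) (inj₁ x) = refl
      joinAdj-sym (inj₂ u) (inj₂ w) = cong₂ (λ c e → c ∧ not e) (symmetric G u w) (isPair-sym a b u w)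

      joinAdj-irrefl : ∀ s → joinAdj s s ≡ false
      joinAdj-irrefl (inj₁ x) = cong (_∧ not (isPair p q x x)) (irreflexive H x)
      joinAdj-irrefl (inj₂ u) = cong (_∧ not (isPair a b u u)) (irreflexive G u)

    join : Graph (m + n)
    join = record
      { adj         = λ i j → joinAdj (splitAt m i) (splitAt m j)
      ; symmetric   = λ i j → joinAdj-sym (splitAt m i) (splitAt m j)
      ; irreflexive = λ i → joinAdj-irrefl (splitAt m i)
      }

    sum-joinAdj : ∀ s (f : Fin m ⊎ Fin n → ℕ) →
      sum (λ j → ⟦ joinAdj s (splitAt m j) ⟧ * f (splitAt m j)) ≡
      sum (λ y → ⟦ joinAdj s (inj₁ y) ⟧ * f (inj₁ y)) + sum (λ w → ⟦ joinAdj s (inj₂ w) ⟧ * f (inj₂ w))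
    sum-joinAdj s f = sum-splitAt m (λ t → ⟦ joinAdj s t ⟧ * f t)

    private
      -- As `c` and `e` differ, no `w` satisfies both disjuncts, so the disjunction may be counted
      -- by addition.
      δ+δ : ∀ {k} {c e : Fin k} → c ≢ e → ∀ (s t : Bool) w →
        ⟦ s ∧ does (c ≟ w) ∨ t ∧ does (e ≟ w) ⟧ ≡ ⟦ s ⟧ * ⟦ does (c ≟ w) ⟧ + ⟦ t ⟧ * ⟦ does (e ≟ w) ⟧
      δ+δ {c = c} {e} c≢e s t w with c ≟ w | e ≟ w
      δ+δ c≢e s     t     w | yes refl | yes refl = ⊥-elim (c≢e refl)
      δ+δ c≢e true  true  w | yes _ | no _  = refl
      δ+δ c≢e true  false w | yes _ | no _  = refl
      δ+δ c≢e false true  w | yes _ | no _  = refl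
      δ+δ c≢e false false w | yes _ | no _  = refl
      δ+δ c≢e true  true  w | no _  | yes _ = refl
      δ+δ c≢e true  false w | no _  | yes _ = refl
      δ+δ c≢e false true  w | no _  | yes _ = refl
      δ+δ c≢e false false w | no _  | yes _ = refl
      δ+δ c≢e true  true  w | no _  | no _  = refl
      δ+δ c≢e true  false w | no _  | no _  = refl
      δ+δ c≢e false true  w | no _  | no _  = refl
      δ+δ c≢e false false w | no _  | no _  = refl

      sum-δ+δ : ∀ {k} {c e : Fin k} → c ≢ e → ∀ s t →
        sum (λ w → ⟦ s ∧ does (c ≟ w) ∨ t ∧ does (e ≟ w) ⟧) ≡ ⟦ s ⟧ + ⟦ t ⟧
      sum-δ+δ {c = c} {e} c≢e s t = begin
        sum (λ w → ⟦ s ∧ does (c ≟ w) ∨ t ∧ does (e ≟ w) ⟧)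
          ≡⟨ sum-cong-≗ (δ+δ c≢e s t) ⟩
        sum (λ w → ⟦ s ⟧ * ⟦ does (c ≟ w) ⟧ + ⟦ t ⟧ * ⟦ does (e ≟ w) ⟧)
          ≡⟨ ∑-distrib-+ (λ w → ⟦ s ⟧ * ⟦ does (c ≟ w) ⟧) (λ w → ⟦ t ⟧ * ⟦ does (e ≟ w) ⟧) ⟩
        sum (λ w → ⟦ s ⟧ * ⟦ does (c ≟ w) ⟧) + sum (λ w → ⟦ t ⟧ * ⟦ does (e ≟ w) ⟧)
          ≡⟨ cong₂ _+_ (single s c) (single t e) ⟩
        ⟦ s ⟧ + ⟦ t ⟧ ∎
        where
        open ≡-Reasoning
        single : ∀ s c → sum (λ w → ⟦ s ⟧ * ⟦ does (c ≟ w) ⟧) ≡ ⟦ s ⟧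
        single s c = trans (sym (*-distribˡ-sum ⟦ s ⟧ (λ w → ⟦ does (c ≟ w) ⟧)))
          (trans (cong (⟦ s ⟧ *_) (sum-δ c)) (*-identityʳ ⟦ s ⟧))

    sum-linkʳ : ∀ x → sum (λ u → ⟦ link x u ⟧) ≡ ⟦ does (p ≟ x) ⟧ + ⟦ does (q ≟ x) ⟧
    sum-linkʳ x = sum-δ+δ (edge≢ G ab) (does (p ≟ x)) (does (q ≟ x))

    sum-linkˡ : ∀ u → sum (λ x → ⟦ link x u ⟧) ≡ ⟦ does (a ≟ u) ⟧ + ⟦ does (b ≟ u) ⟧
    sum-linkˡ u = trans (sum-cong-≗ λ x → cong ⟦_⟧ (swap (does (p ≟ x)) (does (a ≟ u)) (does (q ≟ x)) (does (b ≟ u))))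
      (sum-δ+δ (edge≢ H pq) (does (a ≟ u)) (does (b ≟ u)))
      where
      swap : ∀ s t s′ t′ → s ∧ t ∨ s′ ∧ t′ ≡ t ∧ s ∨ t′ ∧ s′
      swap s t s′ t′ = cong₂ _∨_ (∧-comm s t) (∧-comm s′ t′)

    private
      -- `isPair` marks only genuine edges, so the removed and the kept neighbours partition the
      -- neighbourhood. The loss at an endpoint is exactly what `link` gives back in `join-regular`.
      removed : ∀ {k} (F : Graph k) {c e} → Edge F c e → ∀ u →
        sum (λ w → ⟦ adj F u w ∧ not (isPair c e u w) ⟧) + (⟦ does (c ≟ u) ⟧ + ⟦ does (e ≟ u) ⟧) ≡
        degree F u
      removed F {c} {e} ce u = begin
        sum (λ w → ⟦ adj F u w ∧ not (isPair c e u w) ⟧) + (⟦ does (c ≟ u) ⟧ + ⟦ does (e ≟ u) ⟧)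
          ≡⟨ cong (sum (λ w → ⟦ adj F u w ∧ not (isPair c e u w) ⟧) +_)
               (sum-δ+δ (edge≢ F ce ∘ sym) (does (c ≟ u)) (does (e ≟ u))) ⟨
        sum (λ w → ⟦ adj F u w ∧ not (isPair c e u w) ⟧) + sum (λ w → ⟦ isPair c e u w ⟧)
          ≡⟨ ∑-distrib-+ (λ w → ⟦ adj F u w ∧ not (isPair c e u w) ⟧) (λ w → ⟦ isPair c e u w ⟧) ⟨
        sum (λ w → ⟦ adj F u w ∧ not (isPair c e u w) ⟧ + ⟦ isPair c e u w ⟧)
          ≡⟨ sum-cong-≗ (λ w → partition (adj F u w) (isPair c e u w) (pair⇒edge w)) ⟩
        sum (λ w → ⟦ adj F u w ⟧)
          ≡⟨ degree≡sum F u ⟨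
        degree F u ∎
        where
        open ≡-Reasoning
        partition : ∀ s t → (T t → T s) → ⟦ s ∧ not t ⟧ + ⟦ t ⟧ ≡ ⟦ s ⟧
        partition true  true  _ = refl
        partition true  false _ = refl
        partition false true  f = ⊥-elim (f _)
        partition false false _ = refl

        pair⇒edge : ∀ w → T (isPair c e u w) → Edge F u w
        pair⇒edge w t with isPair⇒≡ c e u w t
        ... | inj₁ (refl , refl) = ce
        ... | inj₂ (refl , refl) = edge-sym F ce

    join-regular : ∀ {d} → Regular H d → Regular G d → Regular join d
    join-regular {d} rH rG i = trans (degree≡sum join i)
      (trans (sum-splitAt m (λ t → ⟦ joinAdj (splitAt m i) t ⟧)) (joinDegree (splitAt m i)))
      where
      joinDegree : ∀ s → sum (λ y → ⟦ joinAdj s (inj₁ y) ⟧) + sum (λ w → ⟦ joinAdj s (inj₂ w) ⟧) ≡ d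
      joinDegree (inj₁ x) = trans (cong (sum (λ y → ⟦ joinAdj (inj₁ x) (inj₁ y) ⟧) +_) (sum-linkʳ x))
        (trans (removed H pq x) (rH x))
      joinDegree (inj₂ u) = trans (+-comm (sum (λ x → ⟦ link x u ⟧)) _)
        (trans (cong (sum (λ w → ⟦ joinAdj (inj₂ u) (inj₂ w) ⟧) +_) (sum-linkˡ u))
        (trans (removed G ab u) (rG u)))

    inl : Fin m → Fin (m + n)
    inl x = x ↑ˡ n

    inr : Fin n → Fin (m + n)
    inr u = m ↑ʳ u

    private
      toJoin : ∀ {i j s t} → splitAt m i ≡ s → splitAt m j ≡ t → T (joinAdj s t) → Edge join i j
      toJoin refl refl e = e

      T-≟-refl : ∀ {k} (v : Fin k) → T (does (v ≟ v))
      T-≟-refl v with v ≟ v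
      ... | yes _   = _
      ... | no  v≢v = v≢v refl

      inl-inr : ∀ {x u} → T (link x u) → Edge join (inl x) (inr u)
      inl-inr {x} {u} = toJoin (splitAt-↑ˡ m x n) (splitAt-↑ʳ m n u)

      ap : Edge join (inl p) (inr a)
      ap = inl-inr (Equivalence.from T-∨ (inj₁ (Equivalence.from T-∧ (T-≟-refl p , T-≟-refl a))))

      bq : Edge join (inl q) (inr b)
      bq = inl-inr (Equivalence.from (T-∨ {does (p ≟ q) ∧ does (a ≟ b)})
             (inj₂ (Equivalence.from T-∧ (T-≟-refl q , T-≟-refl b))))

    -- The two sides play different roles. `H` has to stay connected without `pq`, because a walk in
    -- `G` that used `ab` is rerouted from `a` to `p`, through `H` to `q`, and back to `b`; `ab`
    -- itself may be a bridge of `G`.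
    join-connected : (∀ x y → Star (λ x y → T (adj H x y ∧ not (isPair p q x y))) x y) →
      Connected G → Connected join
    join-connected conH conG i j = subst₂ (Star (Edge join))
      (join-splitAt m n i) (join-splitAt m n j) (connect (splitAt m i) (splitAt m j))
      where
      left : ∀ x y → Star (Edge join) (inl x) (inl y)
      left x y = gmap inl (λ {x} {y} → toJoin (splitAt-↑ˡ m x n) (splitAt-↑ˡ m y n)) (conH x y)

      a⟶b : Star (Edge join) (inr a) (inr b)
      a⟶b = edge-sym join ap ◅ left p q ◅◅ bq ◅ ε

      b⟶a : Star (Edge join) (inr b) (inr a)
      b⟶a = edge-sym join bq ◅ left q p ◅◅ ap ◅ ε

      reroute : ∀ {u w} → Edge G u w → Star (Edge join) (inr u) (inr w)
      reroute {u} {w} uw with T? (isPair a b u w)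
      ... | no ¬pair = toJoin (splitAt-↑ʳ m n u) (splitAt-↑ʳ m n w)
                         (Equivalence.from T-∧ (uw , ¬T⇒T-not ¬pair)) ◅ ε
        where
        ¬T⇒T-not : ∀ {c} → ¬ T c → T (not c)
        ¬T⇒T-not {true}  ¬t = ¬t _
        ¬T⇒T-not {false} ¬t = _
      ... | yes pair with isPair⇒≡ a b u w pair
      ...   | inj₁ (refl , refl) = a⟶b
      ...   | inj₂ (refl , refl) = b⟶a

      right : ∀ u w → Star (Edge join) (inr u) (inr w)
      right u w = kleisliStar inr reroute (conG u w)

      connect : ∀ s t → Star (Edge join) (Fin.join m n s) (Fin.join m n t)
      connect (inj₁ x) (inj₁ y) = left x y
      connect (inj₁ x) (inj₂ u) = left x p ◅◅ ap ◅ right a u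
      connect (inj₂ u) (inj₁ x) = right u a ◅◅ edge-sym join ap ◅ left p x
      connect (inj₂ u) (inj₂ w) = right u w

  -- Paths of blocks, and the attachment of a complete block.

  sumTo : ℕ → (ℕ → ℕ) → ℕ
  sumTo n f = sum {n} (λ i → f (toℕ i))

  -- A bound of 1 says at once that at most one neighbour lies on another level and that this level
  -- is adjacent. Being a sum over neighbours, it can be added directly to the degree in `K*W≤`.
  variation : ∀ {n} → Graph n → (Fin n → ℕ) → Fin n → ℕ
  variation G ℓ u = sum (λ w → ⟦ adj G u w ⟧ * ∣ ℓ u - ℓ w ∣)

  -- The levels number the blocks.  A vertex has at most one neighbour outside its block, and the edge
  -- free, which has no such neighbour, serves to attach the next block.
  record BlockPath (d n : ℕ) : Set where
    field
      graph           : Graph n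
      regular         : Regular graph d
      connected       : Connected graph
      level           : Fin n → ℕ
      top             : ℕ
      level≤top       : ∀ u → level u ≤ top
      variation≤1     : ∀ u → variation graph level u ≤ 1
      -- Every level holds at most 2 d + 1 vertices, the largest size of the circulant block.
      -- Quantifying over `f` gives this in the form in which a decaying weight is summed.
      mass            : ∀ (f : ℕ → ℕ) → sum (λ u → f (level u)) ≤ (d + d + 1) * sumTo (suc top) f
      a b             : Fin n
      free            : Edge graph a b
      level-a         : level a ≡ top
      level-b         : level b ≡ top
      variation-a     : variation graph level a ≡ 0
      variation-b     : variation graph level b ≡ 0

  ∣n-1+n∣≡1 : ∀ n → ∣ n - suc n ∣ ≡ 1
  ∣n-1+n∣≡1 zero    = refl
  ∣n-1+n∣≡1 (suc n) = ∣n-1+n∣≡1 n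

  -- The condition `3 ≤ d` provides four vertices in the new block: the edge 01 is switched with the
  -- free edge of `P`, and the disjoint edge 23 becomes the next free edge. Without 01 the block is
  -- still connected, as 2 is adjacent to all other vertices.
  addBlock : ∀ {d n} → 3 ≤ d → BlockPath d n → BlockPath d (suc d + n)
  addBlock {d@(suc (suc (suc _)))} {n} (s≤s (s≤s (s≤s _))) P = record
    { graph       = join
    ; regular     = join-regular (complete-regular d) P.regular
    ; connected   = join-connected (λ x y → toHub x ◅◅ reverse (λ {u} {w} → sym⁻ {u} {w}) (toHub y)) P.connected
    ; level       = λ i → lev (splitAt (suc d) i)
    ; top         = suc P.top
    ; level≤top   = λ i → lev≤ (splitAt (suc d) i)
    ; variation≤1 = λ i → subst (_≤ 1) (sym (sum-joinAdj (splitAt (suc d) i) (λ t → ∣ lev (splitAt (suc d) i) - lev t ∣)))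
                      (var≤1 (splitAt (suc d) i))
    ; mass        = mass′
    ; a           = inl 2F
    ; b           = inl 3F
    ; free        = _
    ; level-a     = refl
    ; level-b     = refl
    ; variation-a = trans (sum-joinAdj (inj₁ 2F) (λ t → ∣ suc P.top - lev t ∣)) (var-new 2F)
    ; variation-b = trans (sum-joinAdj (inj₁ 3F) (λ t → ∣ suc P.top - lev t ∣)) (var-new 3F)
    }
    where
    module P = BlockPath P
    open Join (complete (suc d)) P.graph {0F} {1F} _ P.free

    Kept : Fin (suc d) → Fin (suc d) → Set
    Kept x y = T (adj (complete (suc d)) x y ∧ not (isPair 0F 1F x y))

    sym⁻ : ∀ {x y} → Kept x y → Kept y x
    sym⁻ {x} {y} = subst T (cong₂ (λ c e → c ∧ not e) (symmetric (complete (suc d)) x y) (isPair-sym 0F 1F x y))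

    toHub : ∀ x → Star Kept x 2F
    toHub 0F = _◅_ {j = 2F} _ ε
    toHub 1F = _◅_ {j = 2F} _ ε
    toHub 2F = ε
    toHub (suc (suc (suc _))) = _◅_ {j = 2F} _ ε

    lev : Fin (suc d) ⊎ Fin n → ℕ
    lev = [ (λ _ → suc P.top) , P.level ]′

    lev≤ : ∀ s → lev s ≤ suc P.top
    lev≤ (inj₁ x) = ≤-refl
    lev≤ (inj₂ u) = m≤n⇒m≤1+n (P.level≤top u)

    ∣top-top∣≡0 : ∣ P.top - P.top ∣ ≡ 0
    ∣top-top∣≡0 = ∣n-n∣≡0 P.top

    -- Links end only at `P.a` and `P.b`, which both lie on the previous top level.
    jump : ∀ x u → T (link x u) → ∣ suc P.top - P.level u ∣ ≡ 1
    jump x u t with Equivalence.to (T-∨ {does (0F ≟ x) ∧ does (P.a ≟ u)}) t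
    ... | inj₁ xu = at-a (Equivalence.to T-∧ xu .proj₂)
      where
      at-a : T (does (P.a ≟ u)) → ∣ suc P.top - P.level u ∣ ≡ 1
      at-a _ with P.a ≟ u
      ... | yes refl = trans (cong ∣ suc P.top -_∣ P.level-a) (trans (∣-∣-comm (suc P.top) P.top) (∣n-1+n∣≡1 P.top))
    ... | inj₂ xu = at-b (Equivalence.to T-∧ xu .proj₂)
      where
      at-b : T (does (P.b ≟ u)) → ∣ suc P.top - P.level u ∣ ≡ 1
      at-b _ with P.b ≟ u
      ... | yes refl = trans (cong ∣ suc P.top -_∣ P.level-b) (trans (∣-∣-comm (suc P.top) P.top) (∣n-1+n∣≡1 P.top))

    link*jump : ∀ x u → ⟦ link x u ⟧ * ∣ suc P.top - P.level u ∣ ≡ ⟦ link x u ⟧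
    link*jump x u with link x u | jump x u
    ... | false | _ = refl
    ... | true  | j = trans (*-identityˡ _) (j _)

    var : Fin (suc d) ⊎ Fin n → ℕ
    var s = sum (λ y → ⟦ joinAdj s (inj₁ y) ⟧ * ∣ lev s - suc P.top ∣) +
            sum (λ w → ⟦ joinAdj s (inj₂ w) ⟧ * ∣ lev s - P.level w ∣)

    var-new : ∀ x → var (inj₁ x) ≡ ⟦ does (0F ≟ x) ⟧ + ⟦ does (1F ≟ x) ⟧
    var-new x = begin
      sum (λ y → ⟦ joinAdj (inj₁ x) (inj₁ y) ⟧ * ∣ P.top - P.top ∣) +
      sum (λ w → ⟦ link x w ⟧ * ∣ suc P.top - P.level w ∣)
        ≡⟨ cong₂ _+_ (sum-zero λ y → trans (cong (⟦ joinAdj (inj₁ x) (inj₁ y) ⟧ *_) ∣top-top∣≡0) (*-zeroʳ ⟦ joinAdj (inj₁ x) (inj₁ y) ⟧))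
                     (sum-cong-≗ (link*jump x)) ⟩
      sum (λ w → ⟦ link x w ⟧)
        ≡⟨ sum-linkʳ x ⟩
      ⟦ does (0F ≟ x) ⟧ + ⟦ does (1F ≟ x) ⟧ ∎
      where open ≡-Reasoning

    var-old : ∀ u → var (inj₂ u) ≤ ⟦ does (P.a ≟ u) ⟧ + ⟦ does (P.b ≟ u) ⟧ + variation P.graph P.level u
    var-old u = begin
      sum (λ x → ⟦ link x u ⟧ * ∣ P.level u - suc P.top ∣) +
      sum (λ w → ⟦ joinAdj (inj₂ u) (inj₂ w) ⟧ * ∣ P.level u - P.level w ∣)
        ≤⟨ +-mono-≤
             (≤-reflexive (sum-cong-≗ λ x → trans (cong (⟦ link x u ⟧ *_) (∣-∣-comm (P.level u) (suc P.top))) (link*jump x u)))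
             (sum-mono-≤ λ w → *-monoˡ-≤ ∣ P.level u - P.level w ∣ (∧-≤ (adj P.graph u w) (not (isPair P.a P.b u w)))) ⟩
      sum (λ x → ⟦ link x u ⟧) + variation P.graph P.level u
        ≡⟨ cong (_+ variation P.graph P.level u) (sum-linkˡ u) ⟩
      ⟦ does (P.a ≟ u) ⟧ + ⟦ does (P.b ≟ u) ⟧ + variation P.graph P.level u ∎
      where
      open ≤-Reasoning
      ∧-≤ : ∀ c e → ⟦ c ∧ e ⟧ ≤ ⟦ c ⟧
      ∧-≤ true  true  = s≤s z≤n
      ∧-≤ true  false = z≤n
      ∧-≤ false _     = z≤n

    var≤1 : ∀ s → var s ≤ 1
    var≤1 (inj₁ x) = subst (_≤ 1) (sym (var-new x)) (0≟+1≟ x)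
      where
      0≟+1≟ : ∀ (x : Fin (suc d)) → ⟦ does (0F ≟ x) ⟧ + ⟦ does (1F ≟ x) ⟧ ≤ 1
      0≟+1≟ 0F            = s≤s z≤n
      0≟+1≟ 1F            = s≤s z≤n
      0≟+1≟ (suc (suc _)) = z≤n
    var≤1 (inj₂ u) = ≤-trans (var-old u) (bound u)
      where
      -- An endpoint of the free edge gains one neighbour on the new level, but its variation was 0
      -- before. The endpoints are distinct, so no vertex gains two.
      bound : ∀ u → ⟦ does (P.a ≟ u) ⟧ + ⟦ does (P.b ≟ u) ⟧ + variation P.graph P.level u ≤ 1
      bound u with P.a ≟ u | P.b ≟ u
      ... | yes a≡u  | yes b≡u = ⊥-elim (edge≢ P.graph P.free (trans a≡u (sym b≡u)))
      ... | yes refl | no _ = ≤-reflexive (cong suc P.variation-a)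
      ... | no _ | yes refl = ≤-reflexive (cong suc P.variation-b)
      ... | no _ | no _     = P.variation≤1 u

    mass′ : ∀ (f : ℕ → ℕ) → sum (λ i → f (lev (splitAt (suc d) i))) ≤ (d + d + 1) * sumTo (suc (suc P.top)) f
    mass′ f = begin
      sum (λ i → f (lev (splitAt (suc d) i)))
        ≡⟨ sum-splitAt (suc d) (f ∘ lev) ⟩
      sum {suc d} (λ _ → f (suc P.top)) + sum (λ u → f (P.level u))
        ≤⟨ +-mono-≤ (≤-trans (≤-reflexive (sum-const (suc d) (f (suc P.top))))
                             (*-monoˡ-≤ (f (suc P.top)) (≤-trans (≤-reflexive (sym (+-comm d 1))) (+-monoˡ-≤ 1 (m≤m+n d d)))))
                    (P.mass f) ⟩
      (d + d + 1) * f (suc P.top) + (d + d + 1) * sumTo (suc P.top) f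
        ≡⟨ *-distribˡ-+ (d + d + 1) (f (suc P.top)) _ ⟨
      (d + d + 1) * (f (suc P.top) + sumTo (suc P.top) f)
        ≡⟨ cong ((d + d + 1) *_) (trans (+-comm (f (suc P.top)) _) (sym (sum-last f (suc P.top)))) ⟩
      (d + d + 1) * sumTo (suc (suc P.top)) f ∎
      where
      open ≤-Reasoning
      sum-last : ∀ (f : ℕ → ℕ) k → sumTo (suc k) f ≡ sumTo k f + f k
      sum-last f zero    = +-identityʳ (f 0)
      sum-last f (suc k) = trans (cong (f 0 +_) (sum-last (f ∘ suc) k)) (sym (+-assoc (f 0) _ _))

  -- Circulant graphs of prescribed degree.

  sumTo-cong : ∀ n {f g} → (∀ k → k < n → f k ≡ g k) → sumTo n f ≡ sumTo n g
  sumTo-cong n f≡g = sum-cong-≗ {n} λ i → f≡g (toℕ i) (toℕ<n i)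

  sumTo-+ : ∀ m {n} f → sumTo (m + n) f ≡ sumTo m f + sumTo n (λ k → f (m + k))
  sumTo-+ m {n} f = trans (sum-↑ m (λ i → f (toℕ i)))
    (cong₂ _+_ (sum-cong-≗ {m} λ i → cong f (toℕ-↑ˡ i n)) (sum-cong-≗ {n} λ j → cong f (toℕ-↑ʳ m j)))

  sumTo-ones : ∀ n {f} → (∀ k → k < n → f k ≡ 1) → sumTo n f ≡ n
  sumTo-ones n f≡1 = trans (sumTo-cong n f≡1) (trans (sum-const n 1) (*-identityʳ n))

  sumTo-zeros : ∀ n {f} → (∀ k → k < n → f k ≡ 0) → sumTo n f ≡ 0
  sumTo-zeros n f≡0 = trans (sumTo-cong n f≡0) (trans (sum-const n 0) (*-zeroʳ n))

  -- Rotation invariance of a row of a circulant matrix. The positions before `a` have distances a,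
  -- ..., 1, which the symmetry turns into b + 1, ..., a + b; the other positions have distances 0,
  -- ..., b.
  sumTo-distance : ∀ a b {g} → (∀ i j → suc i + suc j ≡ a + suc b → g (suc i) ≡ g (suc j)) →
    sumTo (a + suc b) (λ k → g ∣ a - k ∣) ≡ sumTo (a + suc b) g
  sumTo-distance a b {g} g-sym = begin
    sumTo (a + suc b) (λ k → g ∣ a - k ∣)
      ≡⟨ sumTo-+ a (λ k → g ∣ a - k ∣) ⟩
    sumTo a (λ k → g ∣ a - k ∣) + sumTo (suc b) (λ k → g ∣ a - a + k ∣)
      ≡⟨ cong₂ _+_ (sumTo-cong a before) (sumTo-cong (suc b) λ k _ → cong g (∣m-m+n∣≡n a k)) ⟩
    sumTo a (λ k → g (suc b + k)) + sumTo (suc b) g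
      ≡⟨ +-comm (sumTo a (λ k → g (suc b + k))) _ ⟩
    sumTo (suc b) g + sumTo a (λ k → g (suc b + k))
      ≡⟨ sumTo-+ (suc b) g ⟨
    sumTo (suc b + a) g
      ≡⟨ cong (λ n → sumTo n g) (+-comm (suc b) a) ⟩
    sumTo (a + suc b) g ∎
    where
    open ≡-Reasoning
    before : ∀ k → k < a → g ∣ a - k ∣ ≡ g (suc b + k)
    before k k<a with m≤n⇒∃[o]m+o≡n k<a
    ... | i , refl = trans (cong g (trans (∣-∣-comm (suc (k + i)) k)
        (trans (cong ∣ k -_∣ (sym (+-suc k i))) (∣m-m+n∣≡n k (suc i)))))
      (g-sym i (b + k) (solve 3 (λ i b k → con 1 :+ i :+ (con 1 :+ (b :+ k)) := con 1 :+ k :+ i :+ (con 1 :+ b)) refl i b k))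

  -- The connection set of a circulant graph: a subset of ℤ/s of size `d`, closed under negation and
  -- without 0. The offset 1 makes the graph connected and supplies the free edge.
  record Offsets (s d : ℕ) : Set where
    field
      t     : ℕ → Bool
      t₀    : t 0 ≡ false
      t₁    : T (t 1)
      t-sym : ∀ i j → suc i + suc j ≡ s → t (suc i) ≡ t (suc j)
      count : sumTo s (⟦_⟧ ∘ t) ≡ d

  module Circulant {s d} (O : Offsets s d) where
    open Offsets O

    circulant : Graph s
    circulant = record
      { adj         = λ u w → t ∣ toℕ u - toℕ w ∣
      ; symmetric   = λ u w → cong t (∣-∣-comm (toℕ u) (toℕ w))
      ; irreflexive = λ v → trans (cong t (∣n-n∣≡0 (toℕ v))) t₀
      }

    circulant-regular : Regular circulant d
    circulant-regular u with m≤n⇒∃[o]m+o≡n (toℕ<n u)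
    ... | b , u+b≡s = trans (degree≡sum circulant u) (trans (subst
        (λ n → sumTo n (λ k → ⟦ t ∣ toℕ u - k ∣ ⟧) ≡ sumTo n (⟦_⟧ ∘ t)) u+1+b≡s
        (sumTo-distance (toℕ u) b {⟦_⟧ ∘ t} λ i j i+j → cong ⟦_⟧ (t-sym i j (trans i+j u+1+b≡s))))
      count)
      where
      u+1+b≡s : toℕ u + suc b ≡ s
      u+1+b≡s = trans (+-suc (toℕ u) b) u+b≡s

    private
      climb : ∀ k u w → toℕ u + k ≡ toℕ w → Star (Edge circulant) u w
      climb zero    u w u+k≡w = subst (Star _ u) (toℕ-injective (trans (sym (+-identityʳ _)) u+k≡w)) ε
      climb (suc k) u w u+k≡w = step ◅ climb k u⁺ w (trans (cong (_+ k) (toℕ-fromℕ< u⁺<s)) 1+u+k≡w)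
        where
        1+u+k≡w : suc (toℕ u) + k ≡ toℕ w
        1+u+k≡w = trans (sym (+-suc (toℕ u) k)) u+k≡w
        u⁺<s : suc (toℕ u) < s
        u⁺<s = ≤-<-trans (≤-trans (m≤m+n _ k) (≤-reflexive 1+u+k≡w)) (toℕ<n w)
        u⁺ : Fin s
        u⁺ = fromℕ< u⁺<s
        step : Edge circulant u u⁺
        step = subst (T ∘ t) (sym (trans (cong ∣ toℕ u -_∣ (toℕ-fromℕ< u⁺<s)) (∣n-1+n∣≡1 (toℕ u)))) t₁

    circulant-connected : Connected circulant
    circulant-connected u w with ≤-total (toℕ u) (toℕ w)
    ... | inj₁ u≤w = let k , u+k≡w = m≤n⇒∃[o]m+o≡n u≤w in climb k u w u+k≡w
    ... | inj₂ w≤u = let k , w+k≡u = m≤n⇒∃[o]m+o≡n w≤u in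
      reverse (λ {x} {y} → edge-sym circulant {x} {y}) (climb k w u w+k≡u)

  circulantBlock : ∀ {s d} → 2 ≤ s → s ≤ d + d + 1 → Offsets s d → BlockPath d s
  circulantBlock {s} {d} (s≤s (s≤s _)) s≤2d+1 O = record
    { graph       = circulant
    ; regular     = circulant-regular
    ; connected   = circulant-connected
    ; level       = λ _ → 0
    ; top         = 0
    ; level≤top   = λ _ → z≤n
    ; variation≤1 = λ u → ≤-trans (≤-reflexive (constant u)) z≤n
    ; mass        = λ f → ≤-trans (≤-reflexive (sum-const s (f 0)))
                      (*-mono-≤ s≤2d+1 (≤-reflexive (sym (+-identityʳ (f 0)))))
    ; a           = 0F
    ; b           = 1F
    ; free        = Offsets.t₁ O
    ; level-a     = refl
    ; level-b     = refl
    ; variation-a = constant 0F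
    ; variation-b = constant 1F
    }
    where
    open Circulant O
    constant : ∀ u → variation circulant (λ _ → 0) u ≡ 0
    constant u = sum-zero λ w → *-zeroʳ ⟦ adj circulant u w ⟧

  -- The distances 1, …, h and s-h, …, s-1 in ℤ/s, together with s/2 when e holds.
  module SymmetricOffsets (h m : ℕ) (e : Bool) (1≤h : 1 ≤ h) where

    -- The summands stand for the offset 0, the first `h` offsets, the `m` offsets in the middle and
    -- the last `h`.
    s : ℕ
    s = suc (h + (m + h))

    Offset : ℕ → Set
    Offset j = 1 ≤ j × (j ≤ h ⊎ h + m < j ⊎ T e × j + j ≡ s)

    offset? : ∀ j → Dec (Offset j)
    offset? j = 1 ≤? j ×-dec (j ≤? h ⊎-dec (h + m <? j ⊎-dec (T? e ×-dec j + j ≟ℕ s)))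

    private
      on : ∀ {j} → Offset j → ⟦ does (offset? j) ⟧ ≡ 1
      on o = cong ⟦_⟧ (dec-true (offset? _) o)

      off : ∀ {j} → ¬ Offset j → ⟦ does (offset? j) ⟧ ≡ 0
      off ¬o = cong ⟦_⟧ (dec-false (offset? _) ¬o)


      reflect : ∀ i j → suc i + suc j ≡ s → Offset (suc i) → Offset (suc j)
      reflect i j i+j (_ , inj₁ 1+i≤h) = s≤s z≤n , inj₂ (inj₁ (+-cancelˡ-≤ (suc i) (suc (h + m)) (suc j) (begin
        suc i + suc (h + m) ≤⟨ +-monoˡ-≤ (suc (h + m)) 1+i≤h ⟩
        h + suc (h + m)     ≡⟨ solve 2 (λ h m → h :+ (con 1 :+ (h :+ m)) := con 1 :+ (h :+ (m :+ h))) refl h m ⟩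
        s                   ≡⟨ i+j ⟨
        suc i + suc j       ∎)))
        where open ≤-Reasoning
      reflect i j i+j (_ , inj₂ (inj₁ h+m<1+i)) = s≤s z≤n , inj₁ (+-cancelˡ-≤ (suc (h + m)) (suc j) h (begin
        suc (h + m) + suc j ≤⟨ +-monoˡ-≤ (suc j) h+m<1+i ⟩
        suc i + suc j       ≡⟨ i+j ⟩
        s                   ≡⟨ cong suc (+-assoc h m h) ⟨
        suc (h + m) + h     ∎))
        where open ≤-Reasoning
      reflect i j i+j (_ , inj₂ (inj₂ (te , 2i≡s))) = s≤s z≤n , inj₂ (inj₂ (te ,
        subst (λ k → k + k ≡ s) (+-cancelˡ-≡ (suc i) (suc i) (suc j) (trans 2i≡s (sym i+j))) 2i≡s))

    offsets : sumTo m (λ k → ⟦ does (offset? (suc h + k)) ⟧) ≡ ⟦ e ⟧ → Offsets s (h + h + ⟦ e ⟧)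
    offsets middle = record
      { t     = does ∘ offset?
      ; t₀    = refl
      ; t₁    = subst T (sym (dec-true (offset? 1) (s≤s z≤n , inj₁ 1≤h))) _
      ; t-sym = λ i j i+j → does-⇔ (mk⇔ (reflect i j i+j) (reflect j i (trans (+-comm (suc j) (suc i)) i+j)))
                  (offset? (suc i)) (offset? (suc j))
      ; count = begin
          sumTo (h + (m + h)) (λ k → τ (suc k))
            ≡⟨ sumTo-+ h (λ k → τ (suc k)) ⟩
          sumTo h (λ k → τ (suc k)) + sumTo (m + h) (λ k → τ (suc (h + k)))
            ≡⟨ cong (sumTo h (λ k → τ (suc k)) +_) (sumTo-+ m (λ k → τ (suc (h + k)))) ⟩
          sumTo h (λ k → τ (suc k)) + (sumTo m (λ k → τ (suc (h + k))) + sumTo h (λ k → τ (suc (h + (m + k)))))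
            ≡⟨ cong₂ _+_ (sumTo-ones h λ k k<h → on (s≤s z≤n , inj₁ k<h))
                 (cong₂ _+_ middle (sumTo-ones h λ k k<h → on (s≤s z≤n , inj₂ (inj₁ (s≤s (+-monoʳ-≤ h (m≤m+n m k))))))) ⟩
          h + (⟦ e ⟧ + h)
            ≡⟨ solve 2 (λ h e → h :+ (e :+ h) := h :+ h :+ e) refl h ⟦ e ⟧ ⟩
          h + h + ⟦ e ⟧ ∎
      }
      where
      open ≡-Reasoning
      τ : ℕ → ℕ
      τ j = ⟦ does (offset? j) ⟧

    -- The offset h + 1 + k is s / 2 exactly when 2 k + 1 = m, that is, at the midpoint of the
    -- middle range.
    middle-off : ∀ {k} → k < m → ¬ (T e × suc (k + k) ≡ m) → ⟦ does (offset? (suc h + k)) ⟧ ≡ 0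
    middle-off {k} k<m ¬mid = off λ
      { (_ , inj₁ 1+h+k≤h)               → <⇒≱ (s≤s (m≤m+n h k)) 1+h+k≤h
      ; (_ , inj₂ (inj₁ h+m<1+h+k))      → <⇒≱ k<m (+-cancelˡ-≤ h m k (s≤s⁻¹ h+m<1+h+k))
      ; (_ , inj₂ (inj₂ (te , doubled))) → ¬mid (te , +-cancelˡ-≡ (suc (h + h)) (suc (k + k)) m (trans (split h k) (trans doubled s-split)))
      }
      where
      split : ∀ h k → suc (h + h) + suc (k + k) ≡ suc h + k + (suc h + k)
      split = solve 2 (λ h k → con 1 :+ (h :+ h) :+ (con 1 :+ (k :+ k)) := con 1 :+ h :+ k :+ (con 1 :+ h :+ k)) refl
      s-split : s ≡ suc (h + h) + m
      s-split = solve 2 (λ h m → con 1 :+ (h :+ (m :+ h)) := con 1 :+ (h :+ h) :+ m) refl h m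

    middle-on : ∀ {k} → T e → suc (k + k) ≡ m → ⟦ does (offset? (suc h + k)) ⟧ ≡ 1
    middle-on {k} te refl = on (s≤s z≤n , inj₂ (inj₂ (te ,
      solve 2 (λ h k → con 1 :+ h :+ k :+ (con 1 :+ h :+ k) := con 1 :+ (h :+ ((con 1 :+ (k :+ k)) :+ h))) refl h k)))

  evenOffsets : ∀ h m → 1 ≤ h → Offsets (suc (h + (m + h))) (h + h + 0)
  evenOffsets h m 1≤h = offsets (sumTo-zeros m λ k k<m → middle-off k<m λ ())
    where open SymmetricOffsets h m false 1≤h

  -- An odd degree requires the offset s / 2, the only nonzero one that is its own negative. The
  -- middle range has odd length 2 r + 1 so that s = 2 (h + r + 1) is even.
  oddOffsets : ∀ h r → 1 ≤ h → Offsets (suc (h + (suc (r + r) + h))) (h + h + 1)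
  oddOffsets h r 1≤h = offsets (begin
    sumTo (suc (r + r)) τ
      ≡⟨ cong (λ n → sumTo n τ) (+-suc r r) ⟨
    sumTo (r + suc r) τ
      ≡⟨ sumTo-+ r τ ⟩
    sumTo r τ + (τ (r + 0) + sumTo r (λ k → τ (r + suc k)))
      ≡⟨ cong₂ _+_ (sumTo-zeros r below) (cong₂ _+_
           (trans (cong τ (+-identityʳ r)) (middle-on _ refl)) (sumTo-zeros r above)) ⟩
    1 ∎)
    where
    open SymmetricOffsets h (suc (r + r)) true 1≤h
    open ≡-Reasoning
    τ : ℕ → ℕ
    τ k = ⟦ does (offset? (suc h + k)) ⟧

    below : ∀ k → k < r → τ k ≡ 0
    below k k<r = middle-off (m≤n⇒m≤1+n (≤-trans k<r (m≤m+n r r)))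
      λ (_ , mid) → <⇒≢ (+-mono-< k<r k<r) (suc-injective mid)

    above : ∀ k → k < r → τ (r + suc k) ≡ 0
    above k k<r = middle-off (s≤s (+-monoʳ-≤ r k<r))
      λ (_ , mid) → <⇒≢ (+-mono-< r<r+1+k r<r+1+k) (sym (suc-injective mid))
      where
      r<r+1+k : r < r + suc k
      r<r+1+k = m<m+n r (s≤s z≤n)

  -- Parity, and block paths on any admissible number of vertices.

  halve : ∀ n → ∃[ h ] (n ≡ h + h + 0 ⊎ n ≡ h + h + 1)
  halve zero    = 0 , inj₁ refl
  halve (suc n) with halve n
  ... | h , inj₁ refl = h , inj₂ (trans (cong suc (+-identityʳ (h + h))) (+-comm 1 (h + h)))
  ... | h , inj₂ refl = suc h , inj₁ (solve 1 (λ h → con 1 :+ (h :+ h :+ con 1) := con 1 :+ h :+ (con 1 :+ h) :+ con 0) refl h)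

  2∣double : ∀ h → 2 ∣ h + h
  2∣double h = divides h (solve 1 (λ h → h :+ h := h :* con 2) refl h)

  2∤odd : ∀ h → ¬ 2 ∣ h + h + 1
  2∤odd h 2∣odd with () ← ∣1⇒≡1 (∣m+n∣m⇒∣n 2∣odd (2∣double h))

  -- A d-regular block needs more than `d` vertices, so the remainder `r` is merged with one group
  -- of d + 1 vertices. At least one such group exists because `d < n`; the other groups become
  -- complete blocks.
  blockPath : ∀ d n → 3 ≤ d → d < n → 2 ∣ d * n → BlockPath d n
  blockPath d n 3≤d d<n 2∣dn = assemble (n / suc d) (m≡m%n+[m/n]*n n (suc d))
    where
    r : ℕ
    r = n % suc d

    r≤d : r ≤ d
    r≤d = s≤s⁻¹ (m%n<n n (suc d))

    size : suc d + r ≤ d + d + 1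
    size = ≤-trans (≤-reflexive (+-comm 1 (d + r))) (+-monoˡ-≤ 1 (+-monoʳ-≤ d r≤d))

    half≥1 : ∀ {h} → d ≤ h + h + 1 → 1 ≤ h
    half≥1 {zero}  d≤1 = ⊥-elim (<⇒≱ (s≤s (s≤s z≤n)) (≤-trans 3≤d d≤1))
    half≥1 {suc h} _   = s≤s z≤n


    -- For odd `d` the number `n` must be even, and so is d + 1; hence r = n - q (d + 1) is even, as
    -- the offset s / 2 demands.
    2∣r : ∀ h q → d ≡ h + h + 1 → n ≡ r + q * suc d → 2 ∣ r
    2∣r h q d≡ n≡ with euclidsLemma d n prime[2] 2∣dn
    ... | inj₁ 2∣d = ⊥-elim (2∤odd h (subst (2 ∣_) d≡ 2∣d))
    ... | inj₂ 2∣n = ∣m+n∣m⇒∣n (subst (2 ∣_) (trans n≡ (+-comm r _)) 2∣n) (∣n⇒∣m*n q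
            (subst (2 ∣_) (trans (solve 1 (λ h → con 1 :+ h :+ (con 1 :+ h) := con 1 :+ (h :+ h :+ con 1)) refl h) (cong suc (sym d≡)))
              (2∣double (suc h))))

    firstOffsets : ∀ q → n ≡ r + q * suc d → Offsets (suc d + r) d
    firstOffsets q n≡ with halve d
    ... | h , inj₁ d≡ = subst₂ Offsets
            (trans (solve 2 (λ h r → con 1 :+ (h :+ (r :+ h)) := con 1 :+ (h :+ h :+ con 0) :+ r) refl h r) (cong (λ x → suc x + r) (sym d≡)))
            (sym d≡) (evenOffsets h r (half≥1 (≤-trans (≤-reflexive d≡) (+-monoʳ-≤ (h + h) z≤n))))
    ... | h , inj₂ d≡ with halve r
    ...   | i , inj₁ r≡ = subst₂ Offsets
            (trans (solve 2 (λ h i → con 1 :+ (h :+ (con 1 :+ (i :+ i) :+ h)) := con 1 :+ (h :+ h :+ con 1) :+ (i :+ i :+ con 0)) refl h i)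
              (cong₂ (λ x y → suc x + y) (sym d≡) (sym r≡)))
            (sym d≡) (oddOffsets h i (half≥1 (≤-reflexive d≡)))
    ...   | i , inj₂ r≡ = ⊥-elim (2∤odd i (subst (2 ∣_) r≡ (2∣r h q d≡ n≡)))

    extend : BlockPath d (suc d + r) → ∀ k → BlockPath d (k * suc d + (suc d + r))
    extend P zero    = P
    extend P (suc k) = subst (BlockPath d) (sym (+-assoc (suc d) (k * suc d) (suc d + r))) (addBlock 3≤d (extend P k))

    assemble : ∀ q → n ≡ r + q * suc d → BlockPath d n
    assemble zero    n≡ = ⊥-elim (<⇒≱ d<n (≤-trans (≤-reflexive (trans n≡ (+-identityʳ r))) r≤d))
    assemble (suc k) n≡ = subst (BlockPath d)
      (trans (solve 3 (λ k d r → k :* d :+ (d :+ r) := r :+ (d :+ k :* d)) refl k (suc d) r) (sym n≡))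
      (extend (circulantBlock 2≤ size (firstOffsets (suc k) n≡)) k)
      where
      2≤ : 2 ≤ suc d + r
      2≤ = ≤-trans (≤-trans (s≤s (s≤s z≤n)) 3≤d) (≤-trans (n≤1+n d) (m≤m+n (suc d) r))

  -- Integer conductances with geometric decay.

  -- By bias, the random walk with conductances c moves along every edge with probability at least
  -- (1 - ε) / d for ε = 1 / (1 + d K).
  record Conductances {n} (G : Graph n) (d K : ℕ) (v : Fin n) : Set where
    field
      c     : Fin n → Fin n → ℕ
      c-sym : ∀ u w → c u w ≡ c w u
      c-off : ∀ {u w} → adj G u w ≡ false → c u w ≡ 0
      c-on  : ∀ {u w} → Edge G u w → 1 ≤ c u w
      bias  : ∀ {u w} → Edge G u w → K * sum (c u) ≤ suc (d * K) * c u w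
      total : sum (λ u → sum (c u)) ≤ (12 * K + 6) * d * sum (c v)

  -- weight K M k = (K + 1) ^ (M - k) * K ^ k for k ≤ M, and 0 for k > M.
  weight : ℕ → ℕ → ℕ → ℕ
  weight K zero    zero    = 1
  weight K zero    (suc k) = 0
  weight K (suc M) zero    = suc K * weight K M zero
  weight K (suc M) (suc k) = K * weight K M k

  -- An equality for `k < M`; from `k = M` on the left side is 0, so the decay extends to all `k`.
  weight-decay : ∀ K M k → suc K * weight K M (suc k) ≤ K * weight K M k
  weight-decay K zero    k       = ≤-trans (≤-reflexive (*-zeroʳ (suc K))) z≤n
  weight-decay K (suc M) zero    = ≤-reflexive
    (solve 2 (λ K x → (con 1 :+ K) :* (K :* x) := K :* ((con 1 :+ K) :* x)) refl K (weight K M 0))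
  weight-decay K (suc M) (suc k) = ≤-trans
    (≤-reflexive (solve 2 (λ K x → (con 1 :+ K) :* (K :* x) := K :* ((con 1 :+ K) :* x)) refl K (weight K M (suc k))))
    (*-monoʳ-≤ K (weight-decay K M k))

  weight-growth : ∀ K M k → k < M → K * weight K M k ≤ suc K * weight K M (suc k)
  weight-growth K (suc M) zero    _         = ≤-reflexive
    (solve 2 (λ K x → K :* ((con 1 :+ K) :* x) := (con 1 :+ K) :* (K :* x)) refl K (weight K M 0))
  weight-growth K (suc M) (suc k) (s≤s k<M) = ≤-trans (*-monoʳ-≤ K (weight-growth K M k k<M))
    (≤-reflexive (solve 2 (λ K x → K :* ((con 1 :+ K) :* x) := (con 1 :+ K) :* (K :* x)) refl K (weight K M (suc k))))

  weight-positive : ∀ {K} M {k} → 1 ≤ K → k ≤ M → 1 ≤ weight K M k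
  weight-positive zero    {zero}  1≤K k≤M       = ≤-refl
  weight-positive (suc M) {zero}  1≤K k≤M       = ≤-trans (weight-positive M 1≤K z≤n) (m≤m+n (weight _ M 0) _)
  weight-positive (suc M) {suc k} 1≤K (s≤s k≤M) = *-mono-≤ {1} 1≤K (weight-positive M 1≤K k≤M)

  Decaying : ℕ → (ℕ → ℕ) → Set
  Decaying K ω = ∀ k → suc K * ω (suc k) ≤ K * ω k

  decaying⇒antitone : ∀ K ω → Decaying K ω → ∀ {m n} → m ≤ n → ω n ≤ ω m
  decaying⇒antitone K ω dec {m} m≤n = go (≤⇒≤′ m≤n)
    where
    go : ∀ {n} → m ≤′ n → ω n ≤ ω m
    go ≤′-refl           = ≤-refl
    go (≤′-step {n} m≤n) = ≤-trans
      (*-cancelˡ-≤ (suc K) (≤-trans (dec n) (*-monoˡ-≤ (ω n) (n≤1+n K)))) (go m≤n)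

  -- The geometric series of ratio K / (K + 1). In the induction ω 1 and the bound K ω 1 for the
  -- later terms add up to (K + 1) ω 1, which is at most K ω 0.
  decaying-tail : ∀ K L ω → Decaying K ω → sumTo L (ω ∘ suc) ≤ K * ω 0
  decaying-tail K zero    ω dec = z≤n
  decaying-tail K (suc L) ω dec =
    ≤-trans (+-monoʳ-≤ (ω 1) (decaying-tail K L (ω ∘ suc) (dec ∘ suc))) (dec 0)

  -- The two-sided series with peak at `j`: the peak contributes 1 and each tail `K`. The added term
  -- `K * ω j` bounds the part of the left tail that the range cuts off, and each induction step on
  -- `j` moves one term between the two.
  decaying-sum : ∀ K ω → Decaying K ω → ∀ {L j} → j ≤ L →
    sumTo (suc L) (λ k → ω ∣ k - j ∣) + K * ω j ≤ (2 * K + 1) * ω 0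
  decaying-sum K ω dec {L} {zero} _ = begin
    sumTo (suc L) (λ k → ω ∣ k - 0 ∣) + K * ω 0
      ≡⟨ cong (_+ K * ω 0) (sumTo-cong (suc L) λ k _ → cong ω (∣-∣-identityʳ k)) ⟩
    ω 0 + sumTo L (ω ∘ suc) + K * ω 0
      ≤⟨ +-monoˡ-≤ (K * ω 0) (+-monoʳ-≤ (ω 0) (decaying-tail K L ω dec)) ⟩
    ω 0 + K * ω 0 + K * ω 0
      ≡⟨ solve 2 (λ K x → x :+ K :* x :+ K :* x := (con 2 :* K :+ con 1) :* x) refl K (ω 0) ⟩
    (2 * K + 1) * ω 0 ∎
    where open ≤-Reasoning
  decaying-sum K ω dec {suc L} {suc j} (s≤s j≤L) = begin
    ω (suc j) + sumTo (suc L) (λ k → ω ∣ k - j ∣) + K * ω (suc j)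
      ≡⟨ solve 3 (λ K x y → x :+ y :+ K :* x := y :+ (x :+ K :* x)) refl K (ω (suc j)) (sumTo (suc L) (λ k → ω ∣ k - j ∣)) ⟩
    sumTo (suc L) (λ k → ω ∣ k - j ∣) + suc K * ω (suc j)
      ≤⟨ +-monoʳ-≤ (sumTo (suc L) (λ k → ω ∣ k - j ∣)) (dec j) ⟩
    sumTo (suc L) (λ k → ω ∣ k - j ∣) + K * ω j
      ≤⟨ decaying-sum K ω dec j≤L ⟩
    (2 * K + 1) * ω 0 ∎
    where open ≤-Reasoning

  ⟦⟧-true : ∀ {b} → T b → ⟦ b ⟧ ≡ 1
  ⟦⟧-true {true} _ = refl

  conductances : ∀ {d n} (P : BlockPath d n) K → 1 ≤ d → 1 ≤ K → ∀ v →
    Conductances (BlockPath.graph P) d K v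
  conductances {d@(suc e)} {n} P K _ 1≤K v = record
    { c     = c
    ; c-sym = λ u w → cong₂ (λ b k → ⟦ b ⟧ * ω k) (symmetric graph u w) (⊓-comm (D u) (D w))
    ; c-off = λ {u} {w} off → cong (λ b → ⟦ b ⟧ * ω (D u ⊓ D w)) off
    ; c-on  = λ {u} {w} uw → subst (1 ≤_) (sym (c-edge uw))
                (weight-positive top 1≤K (≤-trans (m⊓n≤m (D u) (D w)) (D≤top u)))
    ; bias  = λ {u} {w} uw → ≤-trans (K*W≤ u) (*-monoʳ-≤ (suc (d * K))
                (subst (ω (D u) ≤_) (sym (c-edge uw)) (antitone (m⊓n≤m (D u) (D w)))))
    ; total = total
    }
    where
    open BlockPath P

    -- Scaling by (K + 1) ^ top turns the powers of K / (K + 1) into natural numbers. No distance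
    -- `D u` exceeds the cut-off `top`, so every edge keeps a positive conductance.
    ω : ℕ → ℕ
    ω = weight K top

    antitone : ∀ {k l} → k ≤ l → ω l ≤ ω k
    antitone = decaying⇒antitone K ω (weight-decay K top)

    D : Fin n → ℕ
    D u = ∣ level u - level v ∣

    D≤top : ∀ u → D u ≤ top
    D≤top u = ≤-trans (∣m-n∣≤m⊔n (level u) (level v)) (⊔-lub (level≤top u) (level≤top v))

    c : Fin n → Fin n → ℕ
    c u w = ⟦ adj graph u w ⟧ * ω (D u ⊓ D w)

    c-edge : ∀ {u w} → Edge graph u w → c u w ≡ ω (D u ⊓ D w)
    c-edge {u} {w} uw = trans (cong (_* ω (D u ⊓ D w)) (⟦⟧-true uw)) (*-identityˡ _)

    Δ : Fin n → Fin n → ℕ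
    Δ u w = ∣ level u - level w ∣

    Δ≤1 : ∀ {u w} → Edge graph u w → Δ u w ≤ 1
    Δ≤1 {u} {w} uw = ≤-trans (≤-reflexive (sym (trans (cong (_* Δ u w) (⟦⟧-true uw)) (*-identityˡ _))))
      (≤-trans (term≤sum (λ w → ⟦ adj graph u w ⟧ * Δ u w) w) (variation≤1 u))

    -- An edge changes the level by at most 1, so by the triangle inequality it changes the distance
    -- to the level of `v` by at most 1.
    closer : ∀ {u w} → Edge graph u w → D w < D u → Δ u w ≡ 1 × D u ≡ suc (D w)
    closer {u} {w} uw Dw<Du = ≤-antisym (Δ≤1 uw) 1≤Δ
                           , ≤-antisym (≤-trans triangle (+-monoˡ-≤ (D w) (Δ≤1 uw))) Dw<Du
      where
      triangle : D u ≤ Δ u w + D w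
      triangle = ∣-∣-triangle (level u) (level w) (level v)
      1≤Δ : 1 ≤ Δ u w
      1≤Δ = +-cancelʳ-≤ (D w) 1 (Δ u w) (≤-trans Dw<Du triangle)

    -- Only an edge that leads closer to `v` has a conductance above `ω (D u)`. For it Δ = 1, which
    -- pays for the factor (K + 1) / K.
    K*ω≤ : ∀ {u w} → Edge graph u w → K * ω (D u ⊓ D w) ≤ (K + Δ u w) * ω (D u)
    K*ω≤ {u} {w} uw with ≤-<-connex (D u) (D w)
    ... | inj₁ Du≤Dw = *-mono-≤ (m≤m+n K (Δ u w)) (≤-reflexive (cong ω (m≤n⇒m⊓n≡m Du≤Dw)))
    ... | inj₂ Dw<Du with closer uw Dw<Du
    ...   | Δ≡1 , Du≡1+Dw = begin
      K * ω (D u ⊓ D w)       ≡⟨ cong (λ k → K * ω k) (m≥n⇒m⊓n≡n (<⇒≤ Dw<Du)) ⟩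
      K * ω (D w)             ≤⟨ weight-growth K top (D w) (<-≤-trans Dw<Du (D≤top u)) ⟩
      suc K * ω (suc (D w))   ≡⟨ cong₂ (λ k l → k * ω l) (trans (cong (K +_) Δ≡1) (+-comm K 1)) Du≡1+Dw ⟨
      (K + Δ u w) * ω (D u)   ∎
      where open ≤-Reasoning

    K*c≤ : ∀ u w → K * c u w ≤ (K * ⟦ adj graph u w ⟧ + ⟦ adj graph u w ⟧ * Δ u w) * ω (D u)
    K*c≤ u w with adj graph u w | K*ω≤ {u} {w}
    ... | false | _    = ≤-trans (≤-reflexive (*-zeroʳ K)) z≤n
    ... | true  | K*ω≤ = subst₂ _≤_ (cong (K *_) (sym (*-identityˡ _)))
      (cong₂ (λ k l → (k + l) * ω (D u)) (sym (*-identityʳ K)) (sym (*-identityˡ _))) (K*ω≤ _)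

    -- Over the `d` neighbours the bound `K*c≤` adds up to K d plus the variation, which is at most
    -- 1. This yields `bias`, since every edge at `u` has conductance at least `ω (D u)`.
    K*W≤ : ∀ u → K * sum (c u) ≤ suc (d * K) * ω (D u)
    K*W≤ u = begin
      K * sum (c u)
        ≡⟨ *-distribˡ-sum K (c u) ⟩
      sum (λ w → K * c u w)
        ≤⟨ sum-mono-≤ (K*c≤ u) ⟩
      sum (λ w → (K * ⟦ adj graph u w ⟧ + ⟦ adj graph u w ⟧ * Δ u w) * ω (D u))
        ≡⟨ *-distribʳ-sum (ω (D u)) (λ w → K * ⟦ adj graph u w ⟧ + ⟦ adj graph u w ⟧ * Δ u w) ⟨
      sum (λ w → K * ⟦ adj graph u w ⟧ + ⟦ adj graph u w ⟧ * Δ u w) * ω (D u)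
        ≡⟨ cong (_* ω (D u)) (trans
             (∑-distrib-+ (λ w → K * ⟦ adj graph u w ⟧) (λ w → ⟦ adj graph u w ⟧ * Δ u w))
             (cong (_+ variation graph level u) (trans (sym (*-distribˡ-sum K (λ w → ⟦ adj graph u w ⟧)))
               (cong (K *_) (trans (sym (degree≡sum graph u)) (regular u)))))) ⟩
      (K * d + variation graph level u) * ω (D u)
        ≤⟨ *-monoˡ-≤ (ω (D u)) (+-monoʳ-≤ (K * d) (variation≤1 u)) ⟩
      (K * d + 1) * ω (D u)
        ≡⟨ cong (_* ω (D u)) (trans (+-comm (K * d) 1) (cong suc (*-comm K d))) ⟩
      suc (d * K) * ω (D u) ∎
      where open ≤-Reasoning

    W≤ : ∀ u → sum (c u) ≤ suc d * ω (D u)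
    W≤ u = *-cancelˡ-≤ K {{>-nonZero 1≤K}} (begin
      K * sum (c u)            ≤⟨ K*W≤ u ⟩
      suc (d * K) * ω (D u)    ≤⟨ *-monoˡ-≤ (ω (D u)) (+-monoˡ-≤ (d * K) 1≤K) ⟩
      (K + d * K) * ω (D u)    ≡⟨ cong (_* ω (D u)) (*-comm (suc d) K) ⟩
      (K * suc d) * ω (D u)    ≡⟨ *-assoc K (suc d) (ω (D u)) ⟩
      K * (suc d * ω (D u))    ∎)
      where open ≤-Reasoning

    W-v : sum (c v) ≡ d * ω 0
    W-v = begin
      sum (c v)
        ≡⟨ sum-cong-≗ (λ w → cong (λ k → ⟦ adj graph v w ⟧ * ω (k ⊓ D w)) (∣n-n∣≡0 (level v))) ⟩
      sum (λ w → ⟦ adj graph v w ⟧ * ω 0)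
        ≡⟨ *-distribʳ-sum (ω 0) (λ w → ⟦ adj graph v w ⟧) ⟨
      sum (λ w → ⟦ adj graph v w ⟧) * ω 0
        ≡⟨ cong (_* ω 0) (trans (sym (degree≡sum graph v)) (regular v)) ⟩
      d * ω 0 ∎
      where open ≡-Reasoning

    total : sum (λ u → sum (c u)) ≤ (12 * K + 6) * d * sum (c v)
    total = begin
      sum (λ u → sum (c u))
        ≤⟨ sum-mono-≤ W≤ ⟩
      sum (λ u → suc d * ω (D u))
        ≡⟨ *-distribˡ-sum (suc d) (λ u → ω (D u)) ⟨
      suc d * sum (λ u → ω (D u))
        ≤⟨ *-monoʳ-≤ (suc d) (mass (λ k → ω ∣ k - level v ∣)) ⟩
      suc d * ((d + d + 1) * sumTo (suc top) (λ k → ω ∣ k - level v ∣))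
        ≤⟨ *-monoʳ-≤ (suc d) (*-monoʳ-≤ (d + d + 1) (≤-trans (m≤m+n _ (K * ω (level v)))
             (decaying-sum K ω (weight-decay K top) {j = level v} (level≤top v)))) ⟩
      suc d * ((d + d + 1) * ((2 * K + 1) * ω 0))
        -- The estimate (d + 1) (2 d + 1) ≤ 6 d²: for d = e + 1 the difference is e (4 e + 5). The
        -- factor 6 (2 K + 1) is the constant 12 K + 6.
        ≤⟨ m≤m+n _ (e * (4 * e + 5) * ((2 * K + 1) * ω 0)) ⟩
      suc d * ((d + d + 1) * ((2 * K + 1) * ω 0)) + e * (4 * e + 5) * ((2 * K + 1) * ω 0)
        ≡⟨ solve 3 (λ e K x →
             (con 2 :+ e) :* (((con 1 :+ e) :+ (con 1 :+ e) :+ con 1) :* ((con 2 :* K :+ con 1) :* x))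
             :+ e :* (con 4 :* e :+ con 5) :* ((con 2 :* K :+ con 1) :* x)
             := (con 12 :* K :+ con 6) :* (con 1 :+ e) :* ((con 1 :+ e) :* x)) refl e K (ω 0) ⟩
      (12 * K + 6) * d * (d * ω 0)
        ≡⟨ cong ((12 * K + 6) * d *_) W-v ⟨
      (12 * K + 6) * d * sum (c v) ∎
      where open ≤-Reasoning

open BlockGraphs

-- The reversible walk in rational arithmetic: bias, stationarity and stability.

module RationalWalk where

  open import Defs using (Graph; adj; symmetric; Edge; Connected; Regular)
  open import Data.Rational.Base
  open import Data.Rational.Properties
  open import Data.Rational.Solver using (module +-*-Solver)
  open import Relation.Binary.Construct.Closure.ReflexiveTransitive using (Star; ε; _◅_)
  open +-*-Solver using (solve; con; _:+_; _:*_; _:-_; :-_; _:=_)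
  open SemiringSum ℕ.+-*-semiring using () renaming (sum to sumℕ)
  open SemiringSum (CommutativeRing.semiring +-*-commutativeRing)
    using (sum; sum-cong-≗; ∑-distrib-+; *-distribˡ-sum; *-distribʳ-sum)

  -- Opaque, because the type checker would otherwise unfold the gcds in these fractions.
  opaque
    ι : ℕ → ℚ
    ι n = ℤ.+ n / 1

    inv : ℕ → ℚ
    inv zero    = 0ℚ
    inv (suc k) = ℤ.+ 1 / suc k

  opaque
    unfolding ι inv

    ι-+ : ∀ m n → ι (m ℕ.+ n) ≡ ι m + ι n
    ι-+ m n = toℚᵘ-injective (begin
      toℚᵘ (ι (m ℕ.+ n))                        ≈⟨ toℚᵘ-fromℚᵘ (mkℚᵘ (ℤ.+ (m ℕ.+ n)) 0) ⟩
      mkℚᵘ (ℤ.+ (m ℕ.+ n)) 0                      ≈⟨ ℚᵘ.*≡* (cong (ℤ._* ℤ.+ 1) (sym (cong₂ ℤ._+_ (ℤ.*-identityʳ (ℤ.+ m)) (ℤ.*-identityʳ (ℤ.+ n))))) ⟩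
      mkℚᵘ (ℤ.+ m) 0 ℚᵘ.+ mkℚᵘ (ℤ.+ n) 0            ≈⟨ ℚᵘ.+-cong (toℚᵘ-fromℚᵘ (mkℚᵘ (ℤ.+ m) 0)) (toℚᵘ-fromℚᵘ (mkℚᵘ (ℤ.+ n) 0)) ⟨
      toℚᵘ (ι m) ℚᵘ.+ toℚᵘ (ι n)                ≈⟨ toℚᵘ-homo-+ (ι m) (ι n) ⟨
      toℚᵘ (ι m + ι n)                          ∎)
      where open ℚᵘ.≃-Reasoning

    ι-* : ∀ m n → ι (m ℕ.* n) ≡ ι m * ι n
    ι-* m n = toℚᵘ-injective (begin
      toℚᵘ (ι (m ℕ.* n))                        ≈⟨ toℚᵘ-fromℚᵘ (mkℚᵘ (ℤ.+ (m ℕ.* n)) 0) ⟩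
      mkℚᵘ (ℤ.+ (m ℕ.* n)) 0                      ≈⟨ ℚᵘ.*≡* (cong (ℤ._* ℤ.+ 1) (ℤ.pos-* m n)) ⟩
      mkℚᵘ (ℤ.+ m) 0 ℚᵘ.* mkℚᵘ (ℤ.+ n) 0            ≈⟨ ℚᵘ.*-cong (toℚᵘ-fromℚᵘ (mkℚᵘ (ℤ.+ m) 0)) (toℚᵘ-fromℚᵘ (mkℚᵘ (ℤ.+ n) 0)) ⟨
      toℚᵘ (ι m) ℚᵘ.* toℚᵘ (ι n)                ≈⟨ toℚᵘ-homo-* (ι m) (ι n) ⟨
      toℚᵘ (ι m * ι n)                          ∎)
      where open ℚᵘ.≃-Reasoning

    inv*ι : ∀ {n} → 1 ℕ.≤ n → inv n * ι n ≡ 1ℚ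
    inv*ι {suc k} _ = toℚᵘ-injective (begin
      toℚᵘ (inv (suc k) * ι (suc k))            ≈⟨ toℚᵘ-homo-* (inv (suc k)) (ι (suc k)) ⟩
      toℚᵘ (inv (suc k)) ℚᵘ.* toℚᵘ (ι (suc k))  ≈⟨ ℚᵘ.*-cong (toℚᵘ-fromℚᵘ (mkℚᵘ (ℤ.+ 1) k)) (toℚᵘ-fromℚᵘ (mkℚᵘ (ℤ.+ suc k) 0)) ⟩
      mkℚᵘ (ℤ.+ 1) k ℚᵘ.* mkℚᵘ (ℤ.+ suc k) 0        ≈⟨ ℚᵘ.*≡* (trans (ℤ.*-identityʳ _) (cong (ℤ._*_ (ℤ.+ 1)) (sym (ℤ.*-identityʳ (ℤ.+ suc k))))) ⟩
      ℚᵘ.1ℚᵘ                                    ∎)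
      where open ℚᵘ.≃-Reasoning

    ι-nonNeg : ∀ n → 0ℚ ≤ ι n
    ι-nonNeg n = nonNegative⁻¹ (ι n) {{normalize-nonNeg n 1}}

    inv-nonNeg : ∀ n → 0ℚ ≤ inv n
    inv-nonNeg zero    = ≤-refl
    inv-nonNeg (suc k) = nonNegative⁻¹ (inv (suc k)) {{normalize-nonNeg 1 (suc k)}}

    inv-pos : ∀ {n} → 1 ℕ.≤ n → 0ℚ < inv n
    inv-pos {suc k} _ = positive⁻¹ (inv (suc k)) {{normalize-pos 1 (suc k)}}

    ι-pos : ∀ {n} → 1 ℕ.≤ n → 0ℚ < ι n
    ι-pos {suc k} _ = positive⁻¹ (ι (suc k)) {{normalize-pos (suc k) 1}}

    ι-def : ∀ n → ι n ≡ ℤ.+ n / 1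
    ι-def n = refl

    inv-def : ∀ k → inv (suc k) ≡ ℤ.+ 1 / suc k
    inv-def k = refl

    inv-zero : inv 0 ≡ 0ℚ
    inv-zero = refl

    ι-0 : ι 0 ≡ 0ℚ
    ι-0 = refl

    ι-1 : ι 1 ≡ 1ℚ
    ι-1 = refl

  ι-mono-≤ : ∀ {m n} → m ℕ.≤ n → ι m ≤ ι n
  ι-mono-≤ {m} m≤n with ℕ.m≤n⇒∃[o]m+o≡n m≤n
  ... | o , refl = subst₂ _≤_ (+-identityʳ (ι m)) (sym (ι-+ m o)) (+-monoʳ-≤ (ι m) (ι-nonNeg o))

  ι-cancel-≤ : ∀ {m n} → ι m ≤ ι n → m ℕ.≤ n
  ι-cancel-≤ {m} {n} ιm≤ιn = ℕ.≮⇒≥ λ n<m → <-irrefl refl (<-≤-trans (ι-mono-< n<m) ιm≤ιn)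
    where
    ι-mono-< : n ℕ.< m → ι n < ι m
    ι-mono-< n<m with ℕ.m≤n⇒∃[o]m+o≡n n<m
    ... | o , refl = subst₂ _<_ (+-identityʳ (ι n)) (trans (sym (ι-+ n (suc o))) (cong ι (ℕ.+-suc n o)))
                       (+-monoʳ-< (ι n) (ι-pos {suc o} (ℕ.s≤s ℕ.z≤n)))

  ι-sum : ∀ {n} (f : Fin n → ℕ) → ι (sumℕ f) ≡ sum (ι ∘ f)
  ι-sum {zero}  f = ι-0
  ι-sum {suc n} f = trans (ι-+ (f zero) (sumℕ (f ∘ suc))) (cong (_+_ (ι (f zero))) (ι-sum (f ∘ suc)))

  0≤-≤ : ∀ {p q} → 0ℚ ≤ q - p → p ≤ q
  0≤-≤ {p} {q} 0≤q-p = subst₂ _≤_ (+-identityʳ p) (solve 2 (λ p q → p :+ (q :- p) := q) refl p q)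
    (+-monoʳ-≤ p 0≤q-p)

  ≤-0≤ : ∀ {p q} → p ≤ q → 0ℚ ≤ q - p
  ≤-0≤ {p} {q} p≤q = subst (_≤ q - p) (+-inverseʳ p) (+-monoˡ-≤ (- p) p≤q)

  +-nonNeg : ∀ {p q} → 0ℚ ≤ p → 0ℚ ≤ q → 0ℚ ≤ p + q
  +-nonNeg 0≤p 0≤q = +-mono-≤ 0≤p 0≤q

  *-monoˡ : ∀ r {p q} → 0ℚ ≤ r → p ≤ q → r * p ≤ r * q
  *-monoˡ r 0≤r = *-monoˡ-≤-nonNeg r {{nonNegative 0≤r}}

  *-nonNeg : ∀ {p q} → 0ℚ ≤ p → 0ℚ ≤ q → 0ℚ ≤ p * q
  *-nonNeg {p} {q} 0≤p 0≤q = subst (_≤ p * q) (*-zeroʳ p) (*-monoˡ p 0≤p 0≤q)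

  ∣∣≤ : ∀ {p q} → p ≤ q → - p ≤ q → ∣ p ∣ ≤ q
  ∣∣≤ {p} p≤q -p≤q with ∣p∣≡p∨∣p∣≡-p p
  ... | inj₁ eq = subst (_≤ _) (sym eq) p≤q
  ... | inj₂ eq = subst (_≤ _) (sym eq) -p≤q

  p≤∣p∣ : ∀ p → p ≤ ∣ p ∣
  p≤∣p∣ p with ∣p∣≡p∨∣p∣≡-p p
  ... | inj₁ eq = ≤-reflexive (sym eq)
  ... | inj₂ eq = ≤-trans (0≤-≤ (subst (0ℚ ≤_) (solve 1 (λ p → (:- p) :+ (:- p) := (:- p) :- p) refl p) (+-nonNeg 0≤-p 0≤-p))) (≤-reflexive (sym eq))
    where
    0≤-p : 0ℚ ≤ - p
    0≤-p = subst (0ℚ ≤_) eq (0≤∣p∣ p)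

  -p≤∣p∣ : ∀ p → - p ≤ ∣ p ∣
  -p≤∣p∣ p = subst (- p ≤_) (∣-p∣≡∣p∣ p) (p≤∣p∣ (- p))

  sum-mono : ∀ {n} {f g : Fin n → ℚ} → (∀ i → f i ≤ g i) → sum f ≤ sum g
  sum-mono {zero}  f≤g = ≤-refl
  sum-mono {suc n} f≤g = +-mono-≤ (f≤g zero) (sum-mono (f≤g ∘ suc))

  sum-nonNeg : ∀ {n} {f : Fin n → ℚ} → (∀ i → 0ℚ ≤ f i) → 0ℚ ≤ sum f
  sum-nonNeg {zero}  0≤f = ≤-refl
  sum-nonNeg {suc n} 0≤f = +-nonNeg (0≤f zero) (sum-nonNeg (0≤f ∘ suc))

  term≤sumℚ : ∀ {n} {f : Fin n → ℚ} → (∀ i → 0ℚ ≤ f i) → ∀ i → f i ≤ sum f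
  term≤sumℚ {f = f} 0≤f zero    = subst (_≤ sum f) (+-identityʳ (f zero)) (+-monoʳ-≤ (f zero) (sum-nonNeg (0≤f ∘ suc)))
  term≤sumℚ {f = f} 0≤f (suc i) = ≤-trans (term≤sumℚ (0≤f ∘ suc) i)
    (subst (_≤ sum f) (+-identityˡ _) (+-monoˡ-≤ _ (0≤f zero)))

  sum-neg : ∀ {n} (f : Fin n → ℚ) → sum (λ i → - f i) ≡ - sum f
  sum-neg {zero}  f = refl
  sum-neg {suc n} f = trans (cong (_+_ (- f zero)) (sum-neg (f ∘ suc))) (sym (neg-distrib-+ (f zero) _))

  sum-minus : ∀ {n} (f g : Fin n → ℚ) → sum (λ i → f i - g i) ≡ sum f - sum g
  sum-minus f g = trans (∑-distrib-+ f (λ i → - g i)) (cong (_+_ (sum f)) (sum-neg g))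

  argmax : ∀ {n} (f : Fin (suc n) → ℚ) → ∃[ i ] (∀ j → f j ≤ f i)
  argmax {zero}  f = zero , λ { zero → ≤-refl }
  argmax {suc n} f with argmax (f ∘ suc)
  ... | i , max with ≤-total (f zero) (f (suc i))
  ...   | inj₁ f0≤ = suc i , λ { zero → f0≤ ; (suc j) → max j }
  ...   | inj₂ ≤f0 = zero  , λ { zero → ≤-refl ; (suc j) → ≤-trans (max j) ≤f0 }

  module ReversibleWalk {n} (G : Graph n) {d K v} (connected : Connected G) (regular : Regular G d)
                        (1≤d : 1 ℕ.≤ d) (C : Conductances G d K v) where
    open Conductances C

    W : Fin n → ℕ
    W u = sumℕ (c u)

    Z : ℕ
    Z = sumℕ W

    a : Fin n → Fin n → ℚ
    a u w = ι ⟦ adj G u w ⟧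

    P Q B : Fin n → Fin n → ℚ
    P u w = a u w * inv d
    Q u w = ι (c u w) * inv (W u)
    -- The solution of Q = (1 - ε₀) P + ε₀ B for ε₀ = 1 / (1 + d K), because (1 - ε₀) P equals K a /
    -- (1 + d K).
    B u w = ι (suc (d ℕ.* K)) * Q u w - ι K * a u w

    π : Fin n → ℚ
    π u = ι (W u) * inv Z

    1≤W : ∀ u → 1 ℕ.≤ W u
    1≤W u = ℕ.≤-trans 1≤d (subst (ℕ._≤ W u) (trans (sym (degree≡sum G u)) (regular u)) (sum-mono-≤ ⟦adj⟧≤c))
      where
      ⟦adj⟧≤c : ∀ w → ⟦ adj G u w ⟧ ℕ.≤ c u w
      ⟦adj⟧≤c w with adj G u w | c-on {u} {w}
      ... | true  | on = on _
      ... | false | _  = ℕ.z≤n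

    1≤Z : 1 ℕ.≤ Z
    1≤Z = ℕ.≤-trans (1≤W v) (term≤sum W v)

    Q-off : ∀ {u w} → adj G u w ≡ false → Q u w ≡ 0ℚ
    Q-off {u} {w} off = trans (cong (λ k → ι k * inv (W u)) (c-off off)) (trans (cong (_* inv (W u)) ι-0) (*-zeroˡ (inv (W u))))

    a-off : ∀ {u w} → adj G u w ≡ false → a u w ≡ 0ℚ
    a-off off = trans (cong (λ b → ι ⟦ b ⟧) off) ι-0

    P-off : ∀ {u w} → adj G u w ≡ false → P u w ≡ 0ℚ
    P-off off = trans (cong (_* inv d) (a-off off)) (*-zeroˡ (inv d))

    B-off : ∀ {u w} → adj G u w ≡ false → B u w ≡ 0ℚ
    B-off off = trans (cong₂ (λ x y → ι (suc (d ℕ.* K)) * x - ι K * y) (Q-off off) (a-off off))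
      (solve 2 (λ x y → x :* con 0ℚ :- y :* con 0ℚ := con 0ℚ) refl (ι (suc (d ℕ.* K))) (ι K))

    a-sum : ∀ u → sum (a u) ≡ ι d
    a-sum u = trans (sym (ι-sum (λ w → ⟦ adj G u w ⟧))) (cong ι (trans (sym (degree≡sum G u)) (regular u)))

    P-sum : ∀ u → sum (P u) ≡ 1ℚ
    P-sum u = trans (sym (*-distribʳ-sum (inv d) (a u)))
      (trans (cong (_* inv d) (a-sum u)) (trans (*-comm (ι d) (inv d)) (inv*ι 1≤d)))

    Q-sum : ∀ u → sum (Q u) ≡ 1ℚ
    Q-sum u = trans (sym (*-distribʳ-sum (inv (W u)) (ι ∘ c u)))
      (trans (cong (_* inv (W u)) (sym (ι-sum (c u)))) (trans (*-comm (ι (W u)) (inv (W u))) (inv*ι (1≤W u))))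

    ι-suc-dK : ι (suc (d ℕ.* K)) ≡ 1ℚ + ι d * ι K
    ι-suc-dK = trans (ι-+ 1 (d ℕ.* K)) (cong₂ _+_ ι-1 (ι-* d K))

    B-sum : ∀ u → sum (B u) ≡ 1ℚ
    B-sum u = begin
      sum (B u)
        ≡⟨ sum-minus (λ w → ι (suc (d ℕ.* K)) * Q u w) (λ w → ι K * a u w) ⟩
      sum (λ w → ι (suc (d ℕ.* K)) * Q u w) - sum (λ w → ι K * a u w)
        ≡⟨ cong₂ _-_ (*-distribˡ-sum (ι (suc (d ℕ.* K))) (Q u)) (*-distribˡ-sum (ι K) (a u)) ⟨
      ι (suc (d ℕ.* K)) * sum (Q u) - ι K * sum (a u)
        ≡⟨ cong₂ (λ x y → ι (suc (d ℕ.* K)) * x - ι K * y) (Q-sum u) (a-sum u) ⟩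
      ι (suc (d ℕ.* K)) * 1ℚ - ι K * ι d
        ≡⟨ cong (λ x → x * 1ℚ - ι K * ι d) ι-suc-dK ⟩
      (1ℚ + ι d * ι K) * 1ℚ - ι K * ι d
        ≡⟨ solve 2 (λ x y → (con 1ℚ :+ x :* y) :* con 1ℚ :- y :* x := con 1ℚ) refl (ι d) (ι K) ⟩
      1ℚ ∎
      where open ≡-Reasoning

    P-nonNeg : ∀ u w → 0ℚ ≤ P u w
    P-nonNeg u w = *-nonNeg (ι-nonNeg _) (inv-nonNeg d)

    -- On an edge this is `bias` divided by `W u`; elsewhere both terms vanish.
    B-nonNeg : ∀ u w → 0ℚ ≤ B u w
    B-nonNeg u w with adj G u w in eq
    ... | false = ≤-reflexive (sym (trans (cong₂ (λ x y → ι (suc (d ℕ.* K)) * x - ι K * y) (Q-off eq) ι-0)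
      (solve 2 (λ x y → x :* con 0ℚ :- y :* con 0ℚ := con 0ℚ) refl (ι (suc (d ℕ.* K))) (ι K))))
    ... | true  = subst (0ℚ ≤_) factor (*-nonNeg
        (≤-0≤ (subst₂ _≤_ (ι-* K (W u)) (ι-* (suc (d ℕ.* K)) (c u w)) (ι-mono-≤ (bias (subst T (sym eq) _)))))
        (inv-nonNeg (W u)))
      where
      open ≡-Reasoning
      factor : (ι (suc (d ℕ.* K)) * ι (c u w) - ι K * ι (W u)) * inv (W u) ≡ ι (suc (d ℕ.* K)) * Q u w - ι K * ι 1
      factor = begin
        (ι (suc (d ℕ.* K)) * ι (c u w) - ι K * ι (W u)) * inv (W u)
          ≡⟨ solve 5 (λ s c k W i → (s :* c :- k :* W) :* i := s :* (c :* i) :- k :* (i :* W)) refl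
               (ι (suc (d ℕ.* K))) (ι (c u w)) (ι K) (ι (W u)) (inv (W u)) ⟩
        ι (suc (d ℕ.* K)) * Q u w - ι K * (inv (W u) * ι (W u))
          ≡⟨ cong (λ x → ι (suc (d ℕ.* K)) * Q u w - ι K * x) (trans (inv*ι (1≤W u)) (sym ι-1)) ⟩
        ι (suc (d ℕ.* K)) * Q u w - ι K * ι 1 ∎

    ε₀ : ℚ
    ε₀ = inv (suc (d ℕ.* K))

    -- The terms in `a` cancel because K + 1 / d = (1 + d K) / d. The affine form lets the product ε
    -- θ take the place of `ε₀` in `walk≈Q`.
    mixture : ∀ u w → P u w + ε₀ * (B u w - P u w) ≡ Q u w
    mixture u w = begin
      P u w + ε₀ * (B u w - P u w)
        ≡⟨ solve 6 (λ a i e s q k → a :* i :+ e :* (s :* q :- k :* a :- a :* i) :=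
             a :* i :+ (e :* s) :* q :- e :* a :* (k :+ i)) refl
             (a u w) (inv d) ε₀ (ι (suc (d ℕ.* K))) (Q u w) (ι K) ⟩
      a u w * inv d + (ε₀ * ι (suc (d ℕ.* K))) * Q u w - ε₀ * a u w * (ι K + inv d)
        ≡⟨ cong₂ (λ x y → a u w * inv d + x * Q u w - ε₀ * a u w * y) (inv*ι (ℕ.s≤s ℕ.z≤n)) K+1/d ⟩
      a u w * inv d + 1ℚ * Q u w - ε₀ * a u w * (ι (suc (d ℕ.* K)) * inv d)
        ≡⟨ solve 5 (λ a i e s q → a :* i :+ con 1ℚ :* q :- e :* a :* (s :* i) := a :* i :+ q :- (e :* s) :* (a :* i)) refl
             (a u w) (inv d) ε₀ (ι (suc (d ℕ.* K))) (Q u w) ⟩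
      a u w * inv d + Q u w - (ε₀ * ι (suc (d ℕ.* K))) * (a u w * inv d)
        ≡⟨ cong (λ x → a u w * inv d + Q u w - x * (a u w * inv d)) (inv*ι (ℕ.s≤s ℕ.z≤n)) ⟩
      a u w * inv d + Q u w - 1ℚ * (a u w * inv d)
        ≡⟨ solve 2 (λ p q → p :+ q :- con 1ℚ :* p := q) refl (a u w * inv d) (Q u w) ⟩
      Q u w ∎
      where
      open ≡-Reasoning
      K+1/d : ι K + inv d ≡ ι (suc (d ℕ.* K)) * inv d
      K+1/d = begin
        ι K + inv d
          ≡⟨ cong (_+ inv d) (*-identityʳ (ι K)) ⟨
        ι K * 1ℚ + inv d
          ≡⟨ cong (λ x → ι K * x + inv d) (inv*ι 1≤d) ⟨
        ι K * (inv d * ι d) + inv d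
          ≡⟨ solve 3 (λ k i d → k :* (i :* d) :+ i := (con 1ℚ :+ d :* k) :* i) refl (ι K) (inv d) (ι d) ⟩
        (1ℚ + ι d * ι K) * inv d
          ≡⟨ cong (_* inv d) ι-suc-dK ⟨
        ι (suc (d ℕ.* K)) * inv d ∎

    π-nonNeg : ∀ u → 0ℚ ≤ π u
    π-nonNeg u = *-nonNeg (ι-nonNeg (W u)) (inv-nonNeg Z)

    π-sum : sum π ≡ 1ℚ
    π-sum = trans (sym (*-distribʳ-sum (inv Z) (ι ∘ W)))
      (trans (cong (_* inv Z) (sym (ι-sum W))) (trans (*-comm (ι Z) (inv Z)) (inv*ι 1≤Z)))

    π≤1 : ∀ u → π u ≤ 1ℚ
    π≤1 u = subst (π u ≤_) π-sum (term≤sumℚ π-nonNeg u)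

    c-sumˡ : ∀ w → sum (λ u → ι (c u w)) ≡ ι (W w)
    c-sumˡ w = trans (sum-cong-≗ λ u → cong ι (c-sym u w)) (sym (ι-sum (c w)))

    -- Detailed balance: the flow from `u` to `w` is c u w / Z, which is symmetric.
    π-stationary : ∀ w → sum (λ u → π u * Q u w) ≡ π w
    π-stationary w = begin
      sum (λ u → π u * Q u w)              ≡⟨ sum-cong-≗ balance ⟩
      sum (λ u → ι (c u w) * inv Z)        ≡⟨ *-distribʳ-sum (inv Z) (λ u → ι (c u w)) ⟨
      sum (λ u → ι (c u w)) * inv Z        ≡⟨ cong (_* inv Z) (c-sumˡ w) ⟩
      π w                                  ∎
      where
      open ≡-Reasoning
      balance : ∀ u → π u * Q u w ≡ ι (c u w) * inv Z
      balance u = trans (solve 4 (λ W z c i → W :* z :* (c :* i) := (i :* W) :* (c :* z)) refl (ι (W u)) (inv Z) (ι (c u w)) (inv (W u)))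
        (trans (cong (_* (ι (c u w) * inv Z)) (inv*ι (1≤W u))) (*-identityˡ _))

    π-v : 1ℚ ≤ ι (12 ℕ.* K ℕ.+ 6) * (ι d * π v)
    π-v = subst₂ _≤_ (trans (*-comm (ι Z) (inv Z)) (inv*ι 1≤Z)) rearrange
      (subst₂ _≤_ (*-comm (inv Z) (ι Z)) (*-comm (inv Z) _) (*-monoˡ (inv Z) (inv-nonNeg Z) (ι-mono-≤ total)))
      where
      rearrange : ι ((12 ℕ.* K ℕ.+ 6) ℕ.* d ℕ.* W v) * inv Z ≡ ι (12 ℕ.* K ℕ.+ 6) * (ι d * π v)
      rearrange = trans (cong (_* inv Z) (trans (ι-* ((12 ℕ.* K ℕ.+ 6) ℕ.* d) (W v)) (cong (_* ι (W v)) (ι-* (12 ℕ.* K ℕ.+ 6) d))))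
        (solve 4 (λ k d W z → k :* d :* W :* z := k :* (d :* (W :* z))) refl (ι (12 ℕ.* K ℕ.+ 6)) (ι d) (ι (W v)) (inv Z))

    -- The maximum principle along a path, with an error that the path multiplies by a constant.
    propagate : ∀ {j l} → Star (Edge G) j l → ∀ C → ∃[ C′ ] (∀ (g : Fin n → ℚ) δ →
      (∀ {j l} → Edge G j l → g l ≤ δ + ι (W j) * g j) → g j ≤ ι C * δ → g l ≤ ι C′ * δ)
    propagate ε                 C = C , λ _ _ _ gj≤ → gj≤
    propagate (_◅_ {i} {k} e p) C with propagate p (1 ℕ.+ W i ℕ.* C)
    ... | C′ , bound = C′ , λ g δ step gi≤ → bound g δ step (begin
      g k                            ≤⟨ step e ⟩
      δ + ι (W i) * g i              ≤⟨ +-monoʳ-≤ δ (*-monoˡ (ι (W i)) (ι-nonNeg (W i)) gi≤) ⟩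
      δ + ι (W i) * (ι C * δ)        ≡⟨ solve 3 (λ δ w c → δ :+ w :* (c :* δ) := (con 1ℚ :+ w :* c) :* δ) refl δ (ι (W i)) (ι C) ⟩
      (1ℚ + ι (W i) * ι C) * δ       ≡⟨ cong (_* δ) (trans (ι-+ 1 (W i ℕ.* C)) (cong₂ _+_ ι-1 (ι-* (W i) C))) ⟨
      ι (1 ℕ.+ W i ℕ.* C) * δ        ∎)
      where open ≤-Reasoning

    private
      factor : Fin n → Fin n → ℕ
      factor j l = propagate (connected j l) 0 .proj₁

      -- The maximiser from which the error spreads depends on the vector, so one constant has to
      -- serve all pairs of vertices; a sum stands in for the maximum.
      Cmax : ℕ
      Cmax = sumℕ (λ j → sumℕ (factor j))

      factor≤Cmax : ∀ j l → factor j l ℕ.≤ Cmax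
      factor≤Cmax j l = ℕ.≤-trans (term≤sum (factor j) l) (term≤sum (λ j → sumℕ (factor j)) j)

    module _ (x : Fin n → ℚ) {δ} (0≤δ : 0ℚ ≤ δ)
             (stationary : ∀ j → x j - sum (λ i → x i * Q i j) ≤ δ) where

      private
        -- Up to the factor `Z`, the density of `x` with respect to `π`. By reversibility it is
        -- harmonic when `x` is stationary, so the maximum principle applies to its deficit `g`.
        f : Fin n → ℚ
        f i = x i * inv (W i)

        f*W : ∀ i → f i * ι (W i) ≡ x i
        f*W i = trans (*-assoc (x i) _ _) (trans (cong (x i *_) (inv*ι (1≤W i))) (*-identityʳ (x i)))

        f-max : ∃[ j ] (∀ i → f i ≤ f j)
        f-max = argmax′ v f
          where
          argmax′ : ∀ {n} → Fin n → (f : Fin n → ℚ) → ∃[ j ] (∀ i → f i ≤ f j)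
          argmax′ {suc _} _ = argmax

        top : Fin n
        top = f-max .proj₁

        M : ℚ
        M = f top

        g : Fin n → ℚ
        g i = M - f i

        0≤g : ∀ i → 0ℚ ≤ g i
        0≤g i = ≤-0≤ (f-max .proj₂ i)

        c*g : ∀ j → sum (λ i → ι (c i j) * g i) ≡ M * ι (W j) - sum (λ i → x i * Q i j)
        c*g j = begin
          sum (λ i → ι (c i j) * g i)
            ≡⟨ sum-cong-≗ (λ i → solve 4 (λ c M x w → c :* (M :- x :* w) := c :* M :- x :* (c :* w)) refl (ι (c i j)) M (x i) (inv (W i))) ⟩
          sum (λ i → ι (c i j) * M - x i * Q i j)
            ≡⟨ sum-minus (λ i → ι (c i j) * M) (λ i → x i * Q i j) ⟩
          sum (λ i → ι (c i j) * M) - sum (λ i → x i * Q i j)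
            ≡⟨ cong (_- sum (λ i → x i * Q i j)) (trans (sym (*-distribʳ-sum M (λ i → ι (c i j))))
                 (trans (cong (_* M) (c-sumˡ j)) (*-comm (ι (W j)) M))) ⟩
          M * ι (W j) - sum (λ i → x i * Q i j) ∎
          where open ≡-Reasoning

        -- With conductance at least 1, `g l` is bounded by a single nonnegative term of the sum in
        -- `c*g`. That sum exceeds W j g j only by the defect of stationarity at `j`.
        step : ∀ {j l} → Edge G j l → g l ≤ δ + ι (W j) * g j
        step {j} {l} jl = begin
          g l
            ≡⟨ trans (cong (_* g l) ι-1) (*-identityˡ (g l)) ⟨
          ι 1 * g l
            ≤⟨ *-monoʳ-≤-nonNeg (g l) {{nonNegative (0≤g l)}} (ι-mono-≤ (c-on lj)) ⟩
          ι (c l j) * g l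
            ≤⟨ term≤sumℚ (λ i → *-nonNeg (ι-nonNeg (c i j)) (0≤g i)) l ⟩
          sum (λ i → ι (c i j) * g i)
            ≡⟨ c*g j ⟩
          M * ι (W j) - sum (λ i → x i * Q i j)
            ≡⟨ solve 3 (λ m x s → m :- s := (x :- s) :+ (m :- x)) refl (M * ι (W j)) (x j) (sum (λ i → x i * Q i j)) ⟩
          (x j - sum (λ i → x i * Q i j)) + (M * ι (W j) - x j)
            ≤⟨ +-monoˡ-≤ (M * ι (W j) - x j) (stationary j) ⟩
          δ + (M * ι (W j) - x j)
            ≡⟨ cong (λ y → δ + (M * ι (W j) - y)) (f*W j) ⟨
          δ + (M * ι (W j) - f j * ι (W j))
            ≡⟨ cong (δ +_) (solve 3 (λ m w f → m :* w :- f :* w := w :* (m :- f)) refl M (ι (W j)) (f j)) ⟩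
          δ + ι (W j) * g j ∎
          where
          open ≤-Reasoning
          lj : Edge G l j
          lj = subst T (symmetric G j l) jl

        g≤ : ∀ l → g l ≤ ι Cmax * δ
        g≤ l = ≤-trans
          (propagate (connected top l) 0 .proj₂ g δ step
            (≤-reflexive (trans (+-inverseʳ M) (sym (trans (cong (_* δ) ι-0) (*-zeroˡ δ))))))
          (*-monoʳ-≤-nonNeg δ {{nonNegative 0≤δ}} (ι-mono-≤ (factor≤Cmax top l)))

        S : ℚ
        S = sum (λ i → ι (W i) * g i)

        0≤S : 0ℚ ≤ S
        0≤S = sum-nonNeg λ i → *-nonNeg (ι-nonNeg (W i)) (0≤g i)

        S≤ : S ≤ ι Z * (ι Cmax * δ)
        S≤ = subst (S ≤_) (trans (sym (*-distribʳ-sum (ι Cmax * δ) (ι ∘ W))) (cong (_* (ι Cmax * δ)) (sym (ι-sum W))))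
          (sum-mono λ i → *-monoˡ (ι (W i)) (ι-nonNeg (W i)) (g≤ i))

        sum-x : sum x ≡ ι Z * M - S
        sum-x = begin
          sum x
            ≡⟨ sum-cong-≗ (λ i → trans (sym (f*W i)) (solve 3 (λ f w m → f :* w := w :* m :- w :* (m :- f)) refl (f i) (ι (W i)) M)) ⟩
          sum (λ i → ι (W i) * M - ι (W i) * g i)
            ≡⟨ sum-minus (λ i → ι (W i) * M) (λ i → ι (W i) * g i) ⟩
          sum (λ i → ι (W i) * M) - S
            ≡⟨ cong (_- S) (trans (sym (*-distribʳ-sum M (ι ∘ W))) (cong (_* M) (sym (ι-sum W)))) ⟩
          ι Z * M - S ∎
          where open ≡-Reasoning

      perturbation : ∣ sum x - 1ℚ ∣ ≤ δ → ∀ j → ∣ x j - π j ∣ ≤ (1ℚ + ι Z * ι Cmax) * δ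
      perturbation total≈1 j = begin
        ∣ x j - π j ∣
          ≡⟨ cong ∣_∣ x-π ⟩
        ∣ π j * e ∣
          ≡⟨ trans (∣p*q∣≡∣p∣*∣q∣ (π j) e) (cong (_* ∣ e ∣) (0≤p⇒∣p∣≡p (π-nonNeg j))) ⟩
        π j * ∣ e ∣
          ≤⟨ *-monoʳ-≤-nonNeg ∣ e ∣ {{∣-∣-nonNeg e}} (π≤1 j) ⟩
        1ℚ * ∣ e ∣
          ≡⟨ *-identityˡ ∣ e ∣ ⟩
        ∣ e ∣
          ≤⟨ ∣∣≤ e≤ -e≤ ⟩
        δ + ι Z * (ι Cmax * δ)
          ≡⟨ solve 3 (λ δ z c → δ :+ z :* (c :* δ) := (con 1ℚ :+ z :* c) :* δ) refl δ (ι Z) (ι Cmax) ⟩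
        (1ℚ + ι Z * ι Cmax) * δ ∎
        where
        open ≤-Reasoning
        e : ℚ
        -- From Z M = sum x + S and x j = W j (M - g j) follows x j = π j (sum x + S - Z g j); `e`
        -- is what the bracket has beyond 1.
        e = (sum x - 1ℚ) + (S - ι Z * g j)

        x-π : x j - π j ≡ π j * e
        x-π = sym (begin-equality
          π j * e
            ≡⟨ cong (λ y → π j * ((y - 1ℚ) + (S - ι Z * g j))) sum-x ⟩
          ι (W j) * inv Z * ((ι Z * M - S - 1ℚ) + (S - ι Z * (M - f j)))
            ≡⟨ solve 6 (λ w i z m s f → w :* i :* ((z :* m :- s :- con 1ℚ) :+ (s :- z :* (m :- f))) := (i :* z) :* (f :* w) :- w :* i) refl
                 (ι (W j)) (inv Z) (ι Z) M S (f j) ⟩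
          (inv Z * ι Z) * (f j * ι (W j)) - π j
            ≡⟨ cong₂ (λ y z → y * z - π j) (inv*ι 1≤Z) (f*W j) ⟩
          1ℚ * x j - π j
            ≡⟨ cong (_- π j) (*-identityˡ (x j)) ⟩
          x j - π j ∎)

        e≤ : e ≤ δ + ι Z * (ι Cmax * δ)
        e≤ = +-mono-≤ (≤-trans (p≤∣p∣ _) total≈1)
          (≤-trans (0≤-≤ (subst (0ℚ ≤_) (solve 2 (λ s y → y := s :- (s :- y)) refl S (ι Z * g j)) (*-nonNeg (ι-nonNeg Z) (0≤g j)))) S≤)

        -e≤ : - e ≤ δ + ι Z * (ι Cmax * δ)
        -e≤ = subst (_≤ δ + ι Z * (ι Cmax * δ))
          (solve 3 (λ t s y → (:- t) :+ (y :- s) := :- (t :+ (s :- y))) refl (sum x - 1ℚ) S (ι Z * g j))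
          (+-mono-≤ (≤-trans (-p≤∣p∣ _) total≈1)
            (≤-trans (0≤-≤ (subst (0ℚ ≤_) (solve 2 (λ s y → s := y :- (y :- s)) refl S (ι Z * g j)) 0≤S))
              (*-monoˡ (ι Z) (ι-nonNeg Z) (g≤ j))))

    -- Uniqueness has to be quantitative, because real vectors are only known up to rational errors.
    stability : ∃[ C ] (0ℚ < C × (∀ x δ → 0ℚ ≤ δ → (∀ j → ∣ sum (λ i → x i * Q i j) - x j ∣ ≤ δ) →
      ∣ sum x - 1ℚ ∣ ≤ δ → ∀ j → ∣ x j - π j ∣ ≤ C * δ))
    stability = 1ℚ + ι Z * ι Cmax , <-≤-trans (positive⁻¹ 1ℚ)
        (subst (_≤ 1ℚ + ι Z * ι Cmax) (+-identityʳ 1ℚ) (+-monoʳ-≤ 1ℚ (*-nonNeg (ι-nonNeg Z) (ι-nonNeg Cmax))))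
      , λ x δ 0≤δ stationary → perturbation x 0≤δ λ j → ≤-trans
          (subst (_≤ ∣ sum (λ i → x i * Q i j) - x j ∣) (solve 2 (λ s y → :- (s :- y) := y :- s) refl (sum (λ i → x i * Q i j)) (x j))
            (-p≤∣p∣ (sum (λ i → x i * Q i j) - x j)))
          (stationary j)

open RationalWalk
open import Defs
open import Data.Nat.Divisibility using (_∣_)
open import Data.Rational.Base as ℚ using (ℚ; 0ℚ; 1ℚ; ½; mkℚ)
import Data.Rational.Properties as ℚ
open import Data.Rational.Solver using (module +-*-Solver)
open +-*-Solver using (solve; con; _:+_; _:*_; _:-_; :-_; _:=_)
open SemiringSum (CommutativeRing.semiring ℚ.+-*-commutativeRing)
  using (∑-distrib-+; *-distribˡ-sum) renaming (sum to sumℚ)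

-- Arithmetic of Cauchy reals through the terms of their sequences.

Eventually : (ℕ → Set) → Set
Eventually P = ∃[ N ] (∀ k → N ℕ.≤ k → P k)

eventually-× : ∀ {P R : ℕ → Set} → Eventually P → Eventually R → Eventually (λ k → P k × R k)
eventually-× (M , p) (N , r) = M ℕ.⊔ N , λ k ≤k → p k (ℕ.m⊔n≤o⇒m≤o M N ≤k) , r k (ℕ.m⊔n≤o⇒n≤o M N ≤k)

eventually-map : ∀ {P R : ℕ → Set} → (∀ k → P k → R k) → Eventually P → Eventually R
eventually-map f (N , p) = N , λ k N≤k → f k (p k N≤k)

eventually-∀ : ∀ {n} {P : Fin n → ℕ → Set} → (∀ i → Eventually (P i)) → Eventually (λ k → ∀ i → P i k)
eventually-∀ {zero}  ev = 0 , λ _ _ ()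
eventually-∀ {suc n} ev = eventually-map (λ { k (p , ps) zero → p ; k (p , ps) (suc i) → ps i }) (eventually-× (ev zero) (eventually-∀ (ev ∘ suc)))

witness : ∀ {P : ℕ → Set} → Eventually P → ∃[ k ] P k
witness (N , p) = N , p N ℕ.≤-refl

positive-* : ∀ {p q} → 0ℚ ℚ.< p → 0ℚ ℚ.< q → 0ℚ ℚ.< p ℚ.* q
positive-* {p} {q} 0<p 0<q = subst (ℚ._< p ℚ.* q) (ℚ.*-zeroʳ p) (ℚ.*-monoʳ-<-pos p {{ℚ.positive 0<p}} 0<q)

0<½ : 0ℚ ℚ.< ½
0<½ = ℚ.positive⁻¹ ½

0<1 : 0ℚ ℚ.< 1ℚ
0<1 = ℚ.positive⁻¹ 1ℚ

recip : ∀ q → 0ℚ ℚ.< q → ∃[ r ] (0ℚ ℚ.< r × q ℚ.* r ≡ 1ℚ)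
recip q 0<q = (ℚ.1/ q) {{nonZero}} , ℚ.positive⁻¹ _ {{ℚ.1/pos⇒pos q {{ℚ.positive 0<q}}}} , ℚ.*-inverseʳ q {{nonZero}}
  where nonZero = ℚ.pos⇒nonZero q {{ℚ.positive 0<q}}

divide : ∀ C δ → 0ℚ ℚ.< C → 0ℚ ℚ.< δ → ∃[ η ] (0ℚ ℚ.< η × C ℚ.* η ≡ δ)
divide C δ 0<C 0<δ = let r , 0<r , C*r≡1 = recip C 0<C in r ℚ.* δ , positive-* 0<r 0<δ
  , trans (sym (ℚ.*-assoc C r δ)) (trans (cong (ℚ._* δ) C*r≡1) (ℚ.*-identityˡ δ))

half-< : ∀ {δ} → 0ℚ ℚ.< δ → ½ ℚ.* δ ℚ.< δ
half-< {δ} 0<δ = subst₂ ℚ._<_ (ℚ.+-identityʳ (½ ℚ.* δ))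
  (trans (sym (ℚ.*-distribʳ-+ δ ½ ½)) (ℚ.*-identityˡ δ)) (ℚ.+-monoʳ-< (½ ℚ.* δ) (positive-* 0<½ 0<δ))

halves : ∀ δ → ½ ℚ.* δ ℚ.+ ½ ℚ.* δ ≡ δ
halves δ = trans (sym (ℚ.*-distribʳ-+ δ ½ ½)) (ℚ.*-identityˡ δ)

-- A positive fraction has numerator at least 1, so it is at least the reciprocal of its
-- denominator, here `suc d`.
archimedean : ∀ {q} → 0ℚ ℚ.< q → ∃[ k ] (1ℚ ℚ.≤ ι (suc k) ℚ.* q)
archimedean {q@(mkℚ (ℤ.+ suc m) d _)} _ = d , (begin
  1ℚ                          ≡⟨ trans (ℚ.*-comm (ι (suc d)) (inv (suc d))) (inv*ι {suc d} (ℕ.s≤s ℕ.z≤n)) ⟨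
  ι (suc d) ℚ.* inv (suc d)   ≤⟨ *-monoˡ (ι (suc d)) (ι-nonNeg (suc d)) inv≤q ⟩
  ι (suc d) ℚ.* q             ∎)
  where
  open ℚ.≤-Reasoning
  inv≤q : inv (suc d) ℚ.≤ q
  inv≤q = ℚ.toℚᵘ-cancel-≤ (ℚᵘ.≤-respˡ-≃ (ℚᵘ.≃-sym (subst (λ p → ℚ.toℚᵘ p ℚᵘ.≃ mkℚᵘ (ℤ.+ 1) d) (sym (inv-def d))
    (ℚ.toℚᵘ-fromℚᵘ (mkℚᵘ (ℤ.+ 1) d)))) (ℚᵘ.*≤* (ℤ.*-monoʳ-≤-nonNeg (ℤ.+ suc d) {ℤ.+ 1} {ℤ.+ suc m} (ℤ.+≤+ (ℕ.s≤s ℕ.z≤n)))))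
archimedean {mkℚ (ℤ.+ 0) _ _}       (ℚ.*<* (ℤ.+<+ ()))
archimedean {mkℚ (ℤ.-[1+ _ ]) _ _} (ℚ.*<* ())

seq-sum : ∀ {n} (f : Fin n → ℝ) k → seq (sum f) k ≡ sumℚ (λ i → seq (f i) k)
seq-sum {zero}  f k = refl
seq-sum {suc n} f k = cong (seq (f zero) k ℚ.+_) (seq-sum (f ∘ suc) k)

distance-0 : ∀ {p q δ} → p ≡ q → 0ℚ ℚ.< δ → ℚ.∣ p ℚ.- q ∣ ℚ.< δ
distance-0 {p} {δ = δ} refl = subst (λ z → ℚ.∣ z ∣ ℚ.< δ) (sym (ℚ.+-inverseʳ p))

≈-pointwise : ∀ {x y} → (∀ k → seq x k ≡ seq y k) → x ≈ y
≈-pointwise eq δ 0<δ = 0 , λ k _ → distance-0 (eq k) 0<δ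

≈-sym : ∀ {x y} → x ≈ y → y ≈ x
≈-sym {x} {y} x≈y δ 0<δ = eventually-map (λ k → subst (ℚ._< δ) (trans (sym (ℚ.∣-p∣≡∣p∣ (seq x k ℚ.- seq y k)))
  (cong ℚ.∣_∣ (solve 2 (λ p q → :- (p :- q) := q :- p) refl (seq x k) (seq y k))))) (x≈y δ 0<δ)

+-close : ∀ {p q p′ q′ δ η} → ℚ.∣ p ℚ.- q ∣ ℚ.< δ → ℚ.∣ p′ ℚ.- q′ ∣ ℚ.< η → ℚ.∣ (p ℚ.+ p′) ℚ.- (q ℚ.+ q′) ∣ ℚ.< δ ℚ.+ η
+-close {p} {q} {p′} {q′} p≈q p′≈q′ = ℚ.≤-<-trans
  (subst (λ z → ℚ.∣ z ∣ ℚ.≤ ℚ.∣ p ℚ.- q ∣ ℚ.+ ℚ.∣ p′ ℚ.- q′ ∣)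
    (solve 4 (λ p q p′ q′ → (p :- q) :+ (p′ :- q′) := (p :+ p′) :- (q :+ q′)) refl p q p′ q′)
    (ℚ.∣p+q∣≤∣p∣+∣q∣ (p ℚ.- q) (p′ ℚ.- q′)))
  (ℚ.+-mono-< p≈q p′≈q′)

≈-trans : ∀ {x y z} → x ≈ y → y ≈ z → x ≈ z
≈-trans {x} {y} {z} x≈y y≈z δ 0<δ =
  eventually-map (λ k (p , q) → subst₂ (λ s t → ℚ.∣ s ∣ ℚ.< t)
      (solve 3 (λ x y z → (x :+ y) :- (y :+ z) := x :- z) refl (seq x k) (seq y k) (seq z k)) (halves δ)
      (+-close {seq x k} {seq y k} {seq y k} {seq z k} p q))
    (eventually-× (x≈y _ 0<½δ) (y≈z _ 0<½δ))
  where 0<½δ = positive-* 0<½ 0<δ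

+-cong : ∀ {x y x′ y′} → x ≈ y → x′ ≈ y′ → x + x′ ≈ y + y′
+-cong {x} {y} {x′} {y′} x≈y x′≈y′ δ 0<δ =
  eventually-map (λ k (p , q) → subst (ℚ._<_ _) (halves δ) (+-close {seq x k} {seq y k} {seq x′ k} {seq y′ k} p q))
    (eventually-× (x≈y _ 0<½δ) (x′≈y′ _ 0<½δ))
  where 0<½δ = positive-* 0<½ 0<δ

sum-cong : ∀ {n} {f g : Fin n → ℝ} → (∀ i → f i ≈ g i) → sum f ≈ sum g
sum-cong {zero}          f≈g = ≈-pointwise {0ℝ} {0ℝ} λ _ → refl
sum-cong {suc n} {f} {g} f≈g = +-cong {f zero} {g zero} {sum (f ∘ suc)} {sum (g ∘ suc)}
  (f≈g zero) (sum-cong {f = f ∘ suc} {g ∘ suc} (f≈g ∘ suc))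

bounded : ∀ x → ∃[ C ] (0ℚ ℚ.< C × Eventually (λ k → ℚ.∣ seq x k ∣ ℚ.≤ C))
bounded x with cauchy x 1ℚ 0<1
... | N , near = 1ℚ ℚ.+ ℚ.∣ seq x N ∣ , ℚ.+-mono-<-≤ 0<1 (ℚ.0≤∣p∣ (seq x N)) , N , λ k N≤k → begin
  ℚ.∣ seq x k ∣
    ≡⟨ cong ℚ.∣_∣ (solve 2 (λ p q → p := (p :- q) :+ q) refl (seq x k) (seq x N)) ⟩
  ℚ.∣ (seq x k ℚ.- seq x N) ℚ.+ seq x N ∣
    ≤⟨ ℚ.∣p+q∣≤∣p∣+∣q∣ (seq x k ℚ.- seq x N) (seq x N) ⟩
  ℚ.∣ seq x k ℚ.- seq x N ∣ ℚ.+ ℚ.∣ seq x N ∣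
    ≤⟨ ℚ.+-monoˡ-≤ ℚ.∣ seq x N ∣ (ℚ.<⇒≤ (near k N N≤k ℕ.≤-refl)) ⟩
  1ℚ ℚ.+ ℚ.∣ seq x N ∣ ∎
  where open ℚ.≤-Reasoning

∣*∣< : ∀ p q {C η} → 0ℚ ℚ.< C → ℚ.∣ p ∣ ℚ.≤ C → ℚ.∣ q ∣ ℚ.< η → ℚ.∣ p ℚ.* q ∣ ℚ.< C ℚ.* η
∣*∣< p q {C} {η} 0<C p≤C q<η = begin-strict
  ℚ.∣ p ℚ.* q ∣           ≡⟨ ℚ.∣p*q∣≡∣p∣*∣q∣ p q ⟩
  ℚ.∣ p ∣ ℚ.* ℚ.∣ q ∣     ≤⟨ ℚ.*-monoʳ-≤-nonNeg ℚ.∣ q ∣ {{ℚ.∣-∣-nonNeg q}} p≤C ⟩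
  C ℚ.* ℚ.∣ q ∣           <⟨ ℚ.*-monoʳ-<-pos C {{ℚ.positive 0<C}} q<η ⟩
  C ℚ.* η                 ∎
  where open ℚ.≤-Reasoning

*-congˡ : ∀ x {y z} → y ≈ z → x * y ≈ x * z
*-congˡ x {y} {z} y≈z δ 0<δ = close (bounded x)
  where
  scale : ∀ {C η} → 0ℚ ℚ.< C → C ℚ.* η ≡ δ → ∀ k → ℚ.∣ seq x k ∣ ℚ.≤ C × ℚ.∣ seq y k ℚ.- seq z k ∣ ℚ.< η →
    ℚ.∣ seq x k ℚ.* seq y k ℚ.- seq x k ℚ.* seq z k ∣ ℚ.< δ
  scale 0<C Cη≡δ k (p , q) = subst₂ (λ s t → ℚ.∣ s ∣ ℚ.< t)
    (solve 3 (λ x y z → x :* (y :- z) := x :* y :- x :* z) refl (seq x k) (seq y k) (seq z k)) Cη≡δ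
    (∣*∣< (seq x k) (seq y k ℚ.- seq z k) 0<C p q)

  close : ∃[ C ] (0ℚ ℚ.< C × Eventually (λ k → ℚ.∣ seq x k ∣ ℚ.≤ C)) →
    Eventually (λ k → ℚ.∣ seq x k ℚ.* seq y k ℚ.- seq x k ℚ.* seq z k ∣ ℚ.< δ)
  close (C , 0<C , x≤C) = close′ (divide C δ 0<C 0<δ)
    where
    close′ : ∃[ η ] (0ℚ ℚ.< η × C ℚ.* η ≡ δ) →
      Eventually (λ k → ℚ.∣ seq x k ℚ.* seq y k ℚ.- seq x k ℚ.* seq z k ∣ ℚ.< δ)
    close′ (η , 0<η , Cη≡δ) = eventually-map (scale 0<C Cη≡δ) (eventually-× x≤C (y≈z η 0<η))

≤-pointwise : ∀ {x y} → (∀ k → seq x k ℚ.≤ seq y k) → x ≤ y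
≤-pointwise {x} {y} x≤y δ 0<δ = 0 , λ k _ → ℚ.≤-trans (x≤y k)
  (subst (ℚ._≤ seq y k ℚ.+ δ) (ℚ.+-identityʳ (seq y k)) (ℚ.+-monoʳ-≤ (seq y k) (ℚ.<⇒≤ 0<δ)))

-- θ = q / (x ⊔ q), where the maximum keeps every term of the sequence in [0, 1].
module Quotient (q : ℚ) (0<q : 0ℚ ℚ.< q) (x : ℝ) (q≤x : fromℚ q ≤ x) where

  private
    m : ℕ → ℚ
    m k = seq x k ℚ.⊔ q

    q≤m : ∀ k → q ℚ.≤ m k
    q≤m k = ℚ.p≤q⊔p (seq x k) q

    0<m : ∀ k → 0ℚ ℚ.< m k
    0<m k = ℚ.<-≤-trans 0<q (q≤m k)

    r : ℕ → ℚ
    r k = recip (m k) (0<m k) .proj₁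

    0<r : ∀ k → 0ℚ ℚ.< r k
    0<r k = recip (m k) (0<m k) .proj₂ .proj₁

    t : ℕ → ℚ
    t k = q ℚ.* r k

    t*m : ∀ k → t k ℚ.* m k ≡ q
    t*m k = trans (solve 3 (λ q r m → q :* r :* m := q :* (m :* r)) refl q (r k) (m k))
      (trans (cong (q ℚ.*_) (recip (m k) (0<m k) .proj₂ .proj₂)) (ℚ.*-identityʳ q))

    m-lipschitz : ∀ k l → ℚ.∣ m k ℚ.- m l ∣ ℚ.≤ ℚ.∣ seq x k ℚ.- seq x l ∣
    m-lipschitz k l = ∣∣≤ (difference k l)
      (subst₂ ℚ._≤_ (solve 2 (λ p q → p :- q := :- (q :- p)) refl (m l) (m k)) distance-sym (difference l k))
      where
      distance-sym : ℚ.∣ seq x l ℚ.- seq x k ∣ ≡ ℚ.∣ seq x k ℚ.- seq x l ∣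
      distance-sym = trans (cong ℚ.∣_∣ (solve 2 (λ p q → p :- q := :- (q :- p)) refl (seq x l) (seq x k)))
        (ℚ.∣-p∣≡∣p∣ (seq x k ℚ.- seq x l))

      difference : ∀ k l → m k ℚ.- m l ℚ.≤ ℚ.∣ seq x k ℚ.- seq x l ∣
      difference k l = subst (m k ℚ.- m l ℚ.≤_) (solve 2 (λ a b → a :+ b :- b := a) refl e (m l))
        (ℚ.+-monoˡ-≤ (ℚ.- m l) (ℚ.⊔-lub
          (subst (ℚ._≤ e ℚ.+ m l) (solve 2 (λ p q → (p :- q) :+ q := p) refl (seq x k) (seq x l))
            (ℚ.+-mono-≤ (p≤∣p∣ (seq x k ℚ.- seq x l)) (ℚ.p≤p⊔q (seq x l) q)))
          (subst (ℚ._≤ e ℚ.+ m l) (ℚ.+-identityˡ q) (ℚ.+-mono-≤ (ℚ.0≤∣p∣ (seq x k ℚ.- seq x l)) (q≤m l)))))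
        where e = ℚ.∣ seq x k ℚ.- seq x l ∣

  0≤t : ∀ k → 0ℚ ℚ.≤ t k
  0≤t k = ℚ.<⇒≤ (positive-* 0<q (0<r k))

  t≤1 : ∀ k → t k ℚ.≤ 1ℚ
  t≤1 k = subst (t k ℚ.≤_) (recip (m k) (0<m k) .proj₂ .proj₂)
    (ℚ.*-monoʳ-≤-nonNeg (r k) {{ℚ.nonNegative (ℚ.<⇒≤ (0<r k))}} (q≤m k))

  private
    ∣t∣≤1 : ∀ k → ℚ.∣ t k ∣ ℚ.≤ 1ℚ
    ∣t∣≤1 k = subst (ℚ._≤ 1ℚ) (sym (ℚ.0≤p⇒∣p∣≡p (0≤t k))) (t≤1 k)

    -- As t = q / m, one has q (t k - t l) = t k t l (m l - m k), where both factors `t` are at most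
    -- 1 and `m` varies no more than the sequence of `x`.
    t-cauchy : IsCauchy t
    t-cauchy δ 0<δ with divide 1ℚ (q ℚ.* δ) 0<1 (positive-* 0<q 0<δ)
    ... | η , 0<η , 1η≡qδ with cauchy x η 0<η
    ... | N , near = N , λ k l N≤k N≤l → ℚ.*-cancelˡ-<-nonNeg q {{ℚ.nonNegative (ℚ.<⇒≤ 0<q)}} (begin-strict
      q ℚ.* ℚ.∣ t k ℚ.- t l ∣
        ≡⟨ trans (ℚ.∣p*q∣≡∣p∣*∣q∣ q _) (cong (ℚ._* ℚ.∣ t k ℚ.- t l ∣) (ℚ.0≤p⇒∣p∣≡p (ℚ.<⇒≤ 0<q))) ⟨
      ℚ.∣ q ℚ.* (t k ℚ.- t l) ∣
        ≡⟨ cong ℚ.∣_∣ (q*difference k l) ⟩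
      ℚ.∣ t k ℚ.* (t l ℚ.* (m l ℚ.- m k)) ∣
        <⟨ ∣*∣< (t k) _ 0<1 (∣t∣≤1 k) (∣*∣< (t l) _ 0<1 (∣t∣≤1 l) (ℚ.≤-<-trans (m-lipschitz l k) (near l k N≤l N≤k))) ⟩
      1ℚ ℚ.* (1ℚ ℚ.* η)
        ≡⟨ trans (ℚ.*-identityˡ _) 1η≡qδ ⟩
      q ℚ.* δ ∎)
      where
      open ℚ.≤-Reasoning
      q*difference : ∀ k l → q ℚ.* (t k ℚ.- t l) ≡ t k ℚ.* (t l ℚ.* (m l ℚ.- m k))
      q*difference k l = trans (trans (ℚ.*-distribˡ-+ q (t k) (ℚ.- t l)) (cong₂ (λ a b → a ℚ.* t k ℚ.+ b ℚ.* (ℚ.- t l)) (sym (t*m l)) (sym (t*m k))))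
        (solve 4 (λ s n t m → t :* n :* s :+ s :* m :* (:- t) := s :* (t :* (n :- m))) refl (t k) (m l) (t l) (m k))

  θ : ℝ
  θ = mkℝ t t-cauchy

  -- Termwise the product of `t` with `m` is exactly `q`. Putting `x` for `m` costs at most m - x,
  -- the amount by which a term of `x` falls below `q`, and this becomes arbitrarily small since
  -- `q ≤ x`.
  x*θ≈q : x * θ ≈ fromℚ q
  x*θ≈q δ 0<δ = eventually-map (λ k near → ℚ.≤-<-trans (begin
      ℚ.∣ seq x k ℚ.* t k ℚ.- q ∣
        ≡⟨ cong (λ z → ℚ.∣ seq x k ℚ.* t k ℚ.- z ∣) (t*m k) ⟨
      ℚ.∣ seq x k ℚ.* t k ℚ.- t k ℚ.* m k ∣
        ≡⟨ trans (cong ℚ.∣_∣ (solve 3 (λ x t m → x :* t :- t :* m := t :* (:- (m :- x))) refl (seq x k) (t k) (m k)))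
             (ℚ.∣p*q∣≡∣p∣*∣q∣ (t k) _) ⟩
      ℚ.∣ t k ∣ ℚ.* ℚ.∣ ℚ.- (m k ℚ.- seq x k) ∣
        ≤⟨ ℚ.*-monoʳ-≤-nonNeg _ {{ℚ.∣-∣-nonNeg (ℚ.- (m k ℚ.- seq x k))}} (∣t∣≤1 k) ⟩
      1ℚ ℚ.* ℚ.∣ ℚ.- (m k ℚ.- seq x k) ∣
        ≡⟨ trans (ℚ.*-identityˡ _) (trans (ℚ.∣-p∣≡∣p∣ (m k ℚ.- seq x k)) (ℚ.0≤p⇒∣p∣≡p (≤-0≤ (ℚ.p≤p⊔q (seq x k) q)))) ⟩
      m k ℚ.- seq x k
        ≤⟨ subst (m k ℚ.- seq x k ℚ.≤_) (solve 2 (λ x h → x :+ h :- x := h) refl (seq x k) (½ ℚ.* δ))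
             (ℚ.+-monoˡ-≤ (ℚ.- seq x k) (ℚ.⊔-lub
               (subst (ℚ._≤ seq x k ℚ.+ ½ ℚ.* δ) (ℚ.+-identityʳ (seq x k)) (ℚ.+-monoʳ-≤ (seq x k) (ℚ.<⇒≤ 0<½δ))) near)) ⟩
      ½ ℚ.* δ ∎) (half-< 0<δ))
    (q≤x (½ ℚ.* δ) 0<½δ)
    where
    open ℚ.≤-Reasoning
    0<½δ = positive-* 0<½ 0<δ

-- The stationary distribution and the strategy over the reals.

module StationaryDistribution {n} {G : Graph n} {d K v} (connected : Connected G) (regular : Regular G d)
                              (1≤d : 1 ℕ.≤ d) (C : Conductances G d K v) where

  open ReversibleWalk G connected regular 1≤d C

  opaque
    stationaryDistribution : Fin n → ℝ
    stationaryDistribution i = fromℚ (π i)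

  module _ (M : Matrix n) (M≈Q : ∀ u w → M u w ≈ fromℚ (Q u w)) where

    flow : (Fin n → ℝ) → Fin n → ℝ
    flow ρ j = sum (λ i → ρ i * fromℚ (Q i j))

    flow≈ : ∀ ρ j → sum (λ i → ρ i * M i j) ≈ flow ρ j
    flow≈ ρ j = sum-cong {f = λ i → ρ i * M i j} {g = λ i → ρ i * fromℚ (Q i j)}
      λ i → *-congˡ (ρ i) {M i j} {fromℚ (Q i j)} (M≈Q i j)

    opaque
      unfolding stationaryDistribution

      stationary : IsStationary M stationaryDistribution
      stationary =
          ( (λ i → ≤-pointwise {0ℝ} {stationaryDistribution i} λ _ → π-nonNeg i)
          , ≈-pointwise {sum stationaryDistribution} {1ℝ} (λ k → trans (seq-sum stationaryDistribution k) π-sum))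
        , λ j → ≈-trans {sum (λ i → stationaryDistribution i * M i j)} {flow stationaryDistribution j} {stationaryDistribution j}
            (flow≈ stationaryDistribution j)
            (≈-pointwise {flow stationaryDistribution j} {stationaryDistribution j} λ k →
              trans (seq-sum (λ i → stationaryDistribution i * fromℚ (Q i j)) k) (π-stationary j))

      -- For large `k` the rational vector of the k-th terms of `ρ` is nearly stationary with total
      -- nearly 1, so `stability` brings it close to `π`.
      unique : ∀ ρ → IsStationary M ρ → ∀ i → ρ i ≈ stationaryDistribution i
      unique ρ ((_ , total) , balanced) i δ 0<δ = close stability
        where
        balanced′ : ∀ j → flow ρ j ≈ ρ j
        balanced′ j = ≈-trans {flow ρ j} {sum (λ i → ρ i * M i j)} {ρ j}
          (≈-sym {sum (λ i → ρ i * M i j)} {flow ρ j} (flow≈ ρ j)) (balanced j)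

        Stability : ℚ → Set
        Stability C = ∀ x δ → 0ℚ ℚ.≤ δ → (∀ j → ℚ.∣ sumℚ (λ i → x i ℚ.* Q i j) ℚ.- x j ∣ ℚ.≤ δ) →
          ℚ.∣ sumℚ x ℚ.- 1ℚ ∣ ℚ.≤ δ → ∀ j → ℚ.∣ x j ℚ.- π j ∣ ℚ.≤ C ℚ.* δ

        close : ∃[ C ] (0ℚ ℚ.< C × Stability C) → Eventually (λ k → ℚ.∣ seq (ρ i) k ℚ.- π i ∣ ℚ.< δ)
        close (C , 0<C , stable) = close′ (divide C (½ ℚ.* δ) 0<C (positive-* 0<½ 0<δ))
          where
          close′ : ∃[ η ] (0ℚ ℚ.< η × C ℚ.* η ≡ ½ ℚ.* δ) → Eventually (λ k → ℚ.∣ seq (ρ i) k ℚ.- π i ∣ ℚ.< δ)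
          close′ (η , 0<η , Cη≡) = eventually-map
            (λ k (bal , tot) → ℚ.≤-<-trans (subst (ℚ.∣ seq (ρ i) k ℚ.- π i ∣ ℚ.≤_) Cη≡
                (stable (λ i → seq (ρ i) k) η (ℚ.<⇒≤ 0<η)
                  (λ j → ℚ.<⇒≤ (subst (λ s → ℚ.∣ s ℚ.- seq (ρ j) k ∣ ℚ.< η) (seq-sum (λ i → ρ i * fromℚ (Q i j)) k) (bal j)))
                  (ℚ.<⇒≤ (subst (λ s → ℚ.∣ s ℚ.- 1ℚ ∣ ℚ.< η) (seq-sum ρ k) tot)) i))
              (half-< 0<δ))
            (eventually-× (eventually-∀ λ j → balanced′ j η 0<η) (total η 0<η))

    isTheStationaryDistribution : IsTheStationaryDistribution M stationaryDistribution
    isTheStationaryDistribution = stationary , unique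

  opaque
    unfolding stationaryDistribution

    boosted : ∀ {y} → fromℕ d ≤ y → fromℚ (inv (12 ℕ.* K ℕ.+ 6)) ≤ stationaryDistribution v * y
    boosted {y} d≤y δ 0<δ = eventually-map (λ k d≤yk → begin
      inv (12 ℕ.* K ℕ.+ 6)
        ≡⟨ ℚ.*-identityʳ _ ⟨
      inv (12 ℕ.* K ℕ.+ 6) ℚ.* 1ℚ
        ≤⟨ *-monoˡ (inv (12 ℕ.* K ℕ.+ 6)) (inv-nonNeg _) π-v ⟩
      inv (12 ℕ.* K ℕ.+ 6) ℚ.* (ι (12 ℕ.* K ℕ.+ 6) ℚ.* (ι d ℚ.* π v))
        ≡⟨ trans (sym (ℚ.*-assoc (inv (12 ℕ.* K ℕ.+ 6)) (ι (12 ℕ.* K ℕ.+ 6)) (ι d ℚ.* π v))) (trans (cong (ℚ._* (ι d ℚ.* π v)) (inv*ι (ℕ.≤-trans (ℕ.s≤s ℕ.z≤n) (ℕ.m≤n+m 6 (12 ℕ.* K)))))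
             (trans (ℚ.*-identityˡ _) (ℚ.*-comm (ι d) (π v)))) ⟩
      π v ℚ.* ι d
        ≡⟨ cong (π v ℚ.*_) (ι-def d) ⟩
      π v ℚ.* (ℤ.+ d ℚ./ 1)
        ≤⟨ *-monoˡ (π v) (π-nonNeg v) d≤yk ⟩
      π v ℚ.* (seq y k ℚ.+ δ)
        ≡⟨ ℚ.*-distribˡ-+ (π v) (seq y k) δ ⟩
      π v ℚ.* seq y k ℚ.+ π v ℚ.* δ
        ≤⟨ ℚ.+-monoʳ-≤ (π v ℚ.* seq y k) (ℚ.*-monoʳ-≤-nonNeg δ {{ℚ.nonNegative (ℚ.<⇒≤ 0<δ)}} (π≤1 v)) ⟩
      π v ℚ.* seq y k ℚ.+ 1ℚ ℚ.* δ
        ≡⟨ cong (π v ℚ.* seq y k ℚ.+_) (ℚ.*-identityˡ δ) ⟩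
      π v ℚ.* seq y k ℚ.+ δ ∎) (d≤y δ 0<δ)
      where open ℚ.≤-Reasoning

  module Strategy (x : ℝ) (ε₀≤x : fromℚ ε₀ ≤ x) where

    open Quotient ε₀ (inv-pos (ℕ.s≤s ℕ.z≤n)) x ε₀≤x

    opaque
      strategy : Matrix n
      -- The convex combination (1 - θ) P + θ B with θ = ε₀ / x, where `x` is the given bias.
      strategy u w = fromℚ (P u w) + θ * fromℚ (B u w ℚ.- P u w)

    opaque
      unfolding strategy

      strategy-stochastic : IsStochastic strategy
      strategy-stochastic u =
          (λ w → ≤-pointwise {0ℝ} {strategy u w} λ k → subst (0ℚ ℚ.≤_)
            (solve 3 (λ p t b → (con 1ℚ :- t) :* p :+ t :* b := p :+ t :* (b :- p)) refl (P u w) (seq θ k) (B u w))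
            (+-nonNeg (*-nonNeg (≤-0≤ (t≤1 k)) (P-nonNeg u w)) (*-nonNeg (0≤t k) (B-nonNeg u w))))
        , ≈-pointwise {sum (strategy u)} {1ℝ} λ k → trans (seq-sum (strategy u) k) (row-sum (seq θ k))
        where
        open ≡-Reasoning
        row-sum : ∀ t → sumℚ (λ w → P u w ℚ.+ t ℚ.* (B u w ℚ.- P u w)) ≡ 1ℚ
        row-sum t = begin
          sumℚ (λ w → P u w ℚ.+ t ℚ.* (B u w ℚ.- P u w))
            ≡⟨ ∑-distrib-+ (P u) (λ w → t ℚ.* (B u w ℚ.- P u w)) ⟩
          sumℚ (P u) ℚ.+ sumℚ (λ w → t ℚ.* (B u w ℚ.- P u w))
            ≡⟨ cong (sumℚ (P u) ℚ.+_) (trans (sym (*-distribˡ-sum t (λ w → B u w ℚ.- P u w))) (cong (t ℚ.*_) (sum-minus (B u) (P u)))) ⟩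
          sumℚ (P u) ℚ.+ t ℚ.* (sumℚ (B u) ℚ.- sumℚ (P u))
            ≡⟨ cong₂ (λ p b → p ℚ.+ t ℚ.* (b ℚ.- p)) (P-sum u) (B-sum u) ⟩
          1ℚ ℚ.+ t ℚ.* (1ℚ ℚ.- 1ℚ)
            ≡⟨ solve 1 (λ t → con 1ℚ :+ t :* (con 1ℚ :- con 1ℚ) := con 1ℚ) refl t ⟩
          1ℚ ∎

      strategy-supported : SupportedOnEdges G strategy
      strategy-supported u w off = ≈-pointwise {strategy u w} {0ℝ} λ k →
        trans (cong₂ (λ p b → p ℚ.+ seq θ k ℚ.* (b ℚ.- p)) (P-off off) (B-off off))
          (solve 1 (λ t → con 0ℚ :+ t :* (con 0ℚ :- con 0ℚ) := con 0ℚ) refl (seq θ k))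

      seq-simpleRandomWalk : ∀ u w k → seq (simpleRandomWalk G u w) k ≡ P u w
      seq-simpleRandomWalk u w k with adj G u w
      ... | false = sym (trans (cong (ℚ._* inv d) ι-0) (ℚ.*-zeroˡ (inv d)))
      ... | true  = trans (cong (λ e → seq (1/ℕ e) k) (regular u))
                      (trans (seq-1/ℕ d) (sym (trans (cong (ℚ._* inv d) ι-1) (ℚ.*-identityˡ (inv d)))))
        where
        seq-1/ℕ : ∀ d → seq (1/ℕ d) k ≡ inv d
        seq-1/ℕ zero    = sym inv-zero
        seq-1/ℕ (suc e) = sym (inv-def e)

      -- The biased walk simplifies termwise to P + (x θ) (B - P). Replacing x θ by `ε₀` then gives
      -- `mixture`.
      walk≈Q : ∀ u w → biasedWalk G x strategy u w ≈ fromℚ (Q u w)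
      walk≈Q u w = ≈-trans {biasedWalk G x strategy u w} {p + δ * (x * θ)} {fromℚ (Q u w)}
        (≈-pointwise {biasedWalk G x strategy u w} {p + δ * (x * θ)} λ k →
          trans (cong (λ r → (1ℚ ℚ.- seq x k) ℚ.* r ℚ.+ seq x k ℚ.* (P u w ℚ.+ seq θ k ℚ.* (B u w ℚ.- P u w))) (seq-simpleRandomWalk u w k))
            (solve 4 (λ x p t b → (con 1ℚ :- x) :* p :+ x :* (p :+ t :* (b :- p)) := p :+ (b :- p) :* (x :* t)) refl
              (seq x k) (P u w) (seq θ k) (B u w)))
        (≈-trans {p + δ * (x * θ)} {p + δ * fromℚ ε₀} {fromℚ (Q u w)}
          (+-cong {p} {p} {δ * (x * θ)} {δ * fromℚ ε₀} (≈-pointwise {p} {p} λ _ → refl) (*-congˡ δ {x * θ} {fromℚ ε₀} x*θ≈q))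
          (≈-pointwise {p + δ * fromℚ ε₀} {fromℚ (Q u w)} λ k → trans (cong (P u w ℚ.+_) (ℚ.*-comm (B u w ℚ.- P u w) ε₀)) (mixture u w)))
        where
        p δ : ℝ
        p = fromℚ (P u w)
        δ = fromℚ (B u w ℚ.- P u w)

    boost : ∀ {y} → fromℕ d ≤ y → ∃[ B ] (IsStochastic B × SupportedOnEdges G B ×
      ∃[ ρ ] (IsTheStationaryDistribution (biasedWalk G x B) ρ × (fromℚ (inv (12 ℕ.* K ℕ.+ 6)) ≤ ρ v * y)))
    boost {y} d≤y = strategy , strategy-stochastic , strategy-supported , stationaryDistribution
      , isTheStationaryDistribution (biasedWalk G x strategy) walk≈Q , boosted {y} d≤y

-- Bounds on the floor of n ^ α.

pow : ℚ → ℕ → ℚ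
pow p zero    = 1ℚ
pow p (suc q) = p ℚ.* pow p q

seq-^ : ∀ y q k → seq (y ^ q) k ≡ pow (seq y k) q
seq-^ y zero    k = refl
seq-^ y (suc q) k = cong (seq y k ℚ.*_) (seq-^ y q k)

ι-^ : ∀ m q → ι (m ℕ.^ q) ≡ pow (ι m) q
ι-^ m zero    = ι-1
ι-^ m (suc q) = trans (ι-* m (m ℕ.^ q)) (cong (ι m ℚ.*_) (ι-^ m q))

pow-nonNeg : ∀ {p} → 0ℚ ℚ.≤ p → ∀ q → 0ℚ ℚ.≤ pow p q
pow-nonNeg 0≤p zero    = ℚ.<⇒≤ 0<1
pow-nonNeg 0≤p (suc q) = *-nonNeg 0≤p (pow-nonNeg 0≤p q)

pow-mono : ∀ {p p′} → 0ℚ ℚ.≤ p → p ℚ.≤ p′ → ∀ q → pow p q ℚ.≤ pow p′ q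
pow-mono          0≤p p≤p′ zero    = ℚ.≤-refl
pow-mono {p} {p′} 0≤p p≤p′ (suc q) = ℚ.≤-trans (*-monoˡ p 0≤p (pow-mono 0≤p p≤p′ q))
  (ℚ.*-monoʳ-≤-nonNeg (pow p′ q) {{ℚ.nonNegative (pow-nonNeg (ℚ.≤-trans 0≤p p≤p′) q)}} p≤p′)

-- If 1 / q ≤ α, then n ≤ y ^ q ≤ (d + 1) ^ q. The real inequality is read off at one term of the
-- sequences with tolerance 1, which accounts for the outer `suc`.
power-bound-below : ∀ {n α y d} q → IsPower n α y → IsFloor y d → fromℕ 1 ≤ fromℕ q * α →
  n ℕ.≤ suc (suc d ℕ.^ q)
power-bound-below {n} {α} {y} {d} q isPower (_ , (δ , 0<δ , y<d+1)) 1≤qα =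
  bound (witness (eventually-× (eventually-× (below (IsPower.positive isPower)) y<d+1) (IsPower.lower isPower 1 q 1≤qα 1ℚ 0<1)))
  where
  below : 0ℝ < y → Eventually (λ k → 0ℚ ℚ.≤ seq y k)
  below (η , 0<η , 0<y) = eventually-map (λ k η≤ → ℚ.≤-trans (ℚ.<⇒≤ (subst (0ℚ ℚ.<_) (sym (ℚ.+-identityˡ η)) 0<η)) η≤) 0<y

  bound : ∃[ k ] ((0ℚ ℚ.≤ seq y k × seq y k ℚ.+ δ ℚ.≤ ℤ.+ suc d ℚ./ 1) × ℤ.+ (n ℕ.^ 1) ℚ./ 1 ℚ.≤ seq (y ^ q) k ℚ.+ 1ℚ) →
    n ℕ.≤ suc (suc d ℕ.^ q)
  bound (k , (0≤yk , yk<d+1) , n≤yk^q) = ι-cancel-≤ (begin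
    ι n
      ≡⟨ trans (cong ι (sym (ℕ.*-identityʳ n))) (ι-def (n ℕ.^ 1)) ⟩
    ℤ.+ (n ℕ.^ 1) ℚ./ 1
      ≤⟨ n≤yk^q ⟩
    seq (y ^ q) k ℚ.+ 1ℚ
      ≡⟨ cong (ℚ._+ 1ℚ) (seq-^ y q k) ⟩
    pow (seq y k) q ℚ.+ 1ℚ
      ≤⟨ ℚ.+-monoˡ-≤ 1ℚ (pow-mono 0≤yk yk≤d+1 q) ⟩
    pow (ι (suc d)) q ℚ.+ 1ℚ
      ≡⟨ cong (ℚ._+ 1ℚ) (ι-^ (suc d) q) ⟨
    ι (suc d ℕ.^ q) ℚ.+ 1ℚ
      ≡⟨ trans (ℚ.+-comm (ι (suc d ℕ.^ q)) 1ℚ) (sym (trans (ι-+ 1 (suc d ℕ.^ q)) (cong (ℚ._+ ι (suc d ℕ.^ q)) ι-1))) ⟩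
    ι (suc (suc d ℕ.^ q)) ∎)
    where
    open ℚ.≤-Reasoning
    yk≤d+1 : seq y k ℚ.≤ ι (suc d)
    yk≤d+1 = ℚ.≤-trans (subst (ℚ._≤ seq y k ℚ.+ δ) (ℚ.+-identityʳ (seq y k)) (ℚ.+-monoʳ-≤ (seq y k) (ℚ.<⇒≤ 0<δ)))
      (subst (seq y k ℚ.+ δ ℚ.≤_) (sym (ι-def (suc d))) yk<d+1)

-- If n = m + 1 ≤ d, the terms of `y` are eventually at least `m`, while y ^ (p + 1) ≤ n ^ p. Each
-- of the two real inequalities is used with tolerance 1.
power-bound-above : ∀ {m α y d} p → IsPower (suc m) α y → IsFloor y d → fromℕ (suc p) * α ≤ fromℕ p →
  suc m ℕ.≤ d → m ℕ.^ suc p ℕ.≤ suc (suc m ℕ.^ p)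
power-bound-above {m} {α} {y} {d} p isPower (d≤y , _) qα≤p n≤d =
  bound (witness (eventually-× (d≤y 1ℚ 0<1) (IsPower.upper isPower p (suc p) qα≤p 1ℚ 0<1)))
  where
  bound : ∃[ k ] ((ℤ.+ d ℚ./ 1 ℚ.≤ seq y k ℚ.+ 1ℚ) × seq (y ^ suc p) k ℚ.≤ ℤ.+ (suc m ℕ.^ p) ℚ./ 1 ℚ.+ 1ℚ) →
    m ℕ.^ suc p ℕ.≤ suc (suc m ℕ.^ p)
  bound (k , d≤yk , yk^q≤) = ι-cancel-≤ (begin
    ι (m ℕ.^ suc p)
      ≡⟨ ι-^ m (suc p) ⟩
    pow (ι m) (suc p)
      ≤⟨ pow-mono (ι-nonNeg m) m≤yk (suc p) ⟩
    pow (seq y k) (suc p)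
      ≡⟨ seq-^ y (suc p) k ⟨
    seq (y ^ suc p) k
      ≤⟨ yk^q≤ ⟩
    ℤ.+ (suc m ℕ.^ p) ℚ./ 1 ℚ.+ 1ℚ
      ≡⟨ cong (ℚ._+ 1ℚ) (ι-def (suc m ℕ.^ p)) ⟨
    ι (suc m ℕ.^ p) ℚ.+ 1ℚ
      ≡⟨ ι-suc (suc m ℕ.^ p) ⟨
    ι (suc (suc m ℕ.^ p)) ∎)
    where
    open ℚ.≤-Reasoning
    ι-suc : ∀ n → ι (suc n) ≡ ι n ℚ.+ 1ℚ
    ι-suc n = trans (ι-+ 1 n) (trans (cong (ℚ._+ ι n) ι-1) (ℚ.+-comm 1ℚ (ι n)))
    m≤yk : ι m ℚ.≤ seq y k
    m≤yk = subst₂ ℚ._≤_ (solve 1 (λ x → x :+ con 1ℚ :- con 1ℚ := x) refl (ι m)) (solve 1 (λ x → x :+ con 1ℚ :- con 1ℚ := x) refl (seq y k))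
      (ℚ.+-monoˡ-≤ (ℚ.- 1ℚ) (ℚ.≤-trans (ℚ.≤-reflexive (sym (ι-suc m)))
        (ℚ.≤-trans (ι-mono-≤ n≤d) (subst (ℚ._≤ seq y k ℚ.+ 1ℚ) (sym (ι-def d)) d≤yk))))

-- With n = m + 1 ≤ 2 m the hypothesis gives n ^ (p + 1) ≤ 2 ^ (p + 2) * n ^ p.
power-gap : ∀ m p → 1 ℕ.≤ m → m ℕ.^ suc p ℕ.≤ suc (suc m ℕ.^ p) → suc m ℕ.≤ 2 ℕ.^ suc (suc p)
power-gap m p 1≤m m^q≤ = ℕ.*-cancelʳ-≤ (suc m) _ (suc m ℕ.^ p) {{ℕ.m^n≢0 (suc m) p}} (begin
  suc m ℕ.^ suc p
    ≤⟨ ℕ.^-monoˡ-≤ (suc p) suc-m≤2m ⟩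
  (2 ℕ.* m) ℕ.^ suc p
    ≡⟨ *-^ 2 m (suc p) ⟩
  2 ℕ.^ suc p ℕ.* m ℕ.^ suc p
    ≤⟨ ℕ.*-monoʳ-≤ (2 ℕ.^ suc p) (ℕ.≤-trans m^q≤ (ℕ.+-mono-≤ (ℕ.m^n>0 (suc m) p) (ℕ.m≤m+n (suc m ℕ.^ p) 0))) ⟩
  2 ℕ.^ suc p ℕ.* (2 ℕ.* suc m ℕ.^ p)
    ≡⟨ trans (sym (ℕ.*-assoc (2 ℕ.^ suc p) 2 (suc m ℕ.^ p))) (cong (ℕ._* suc m ℕ.^ p) (ℕ.*-comm (2 ℕ.^ suc p) 2)) ⟩
  2 ℕ.^ suc (suc p) ℕ.* suc m ℕ.^ p ∎)
  where
  open ℕ.≤-Reasoning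
  *-^ : ∀ k l q → (k ℕ.* l) ℕ.^ q ≡ k ℕ.^ q ℕ.* l ℕ.^ q
  *-^ k l zero    = refl
  *-^ k l (suc q) = trans (cong (k ℕ.* l ℕ.*_) (*-^ k l q)) (ℕ.[m*n]*[o*p]≡[m*o]*[n*p] k l (k ℕ.^ q) (l ℕ.^ q))

  suc-m≤2m : suc m ℕ.≤ 2 ℕ.* m
  suc-m≤2m = ℕ.+-mono-≤ 1≤m (ℕ.m≤m+n m 0)

-- An integer bound for the reciprocal of `x`: for c₁ it provides `K`, for `α` a root exponent `q`
-- with 1 ≤ q α.
positive⇒≥1/q : ∀ x → 0ℝ < x → ∃[ K ] (1 ℕ.≤ K × Eventually (λ k → 1ℚ ℚ.≤ ι K ℚ.* seq x k))
positive⇒≥1/q x (δ , 0<δ , 0<x) = scale (archimedean 0<δ)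
  where
  scale : ∃[ k ] (1ℚ ℚ.≤ ι (suc k) ℚ.* δ) → _
  scale (k , 1≤) = suc k , ℕ.s≤s ℕ.z≤n , eventually-map (λ i δ≤ → ℚ.≤-trans 1≤
    (*-monoˡ (ι (suc k)) (ι-nonNeg (suc k)) (subst (ℚ._≤ seq x i) (ℚ.+-identityˡ δ) δ≤))) 0<x

eventually-≤ : ∀ {x y} → Eventually (λ k → seq x k ℚ.≤ seq y k) → x ≤ y
eventually-≤ {x} {y} ev δ 0<δ = eventually-map (λ k x≤y → ℚ.≤-trans x≤y
  (subst (ℚ._≤ seq y k ℚ.+ δ) (ℚ.+-identityʳ (seq y k)) (ℚ.+-monoʳ-≤ (seq y k) (ℚ.<⇒≤ 0<δ)))) ev

degree≥3 : ∀ {α} → 0ℝ < α → ∃[ N ] (∀ n y d → N ℕ.≤ n → IsPower n α y → IsFloor y d → 3 ℕ.≤ d)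
degree≥3 {α} 0<α = bound (positive⇒≥1/q α 0<α)
  where
  bound : ∃[ q ] (1 ℕ.≤ q × Eventually (λ k → 1ℚ ℚ.≤ ι q ℚ.* seq α k)) → _
  -- For `d ≤ 2` the lower bound would give n ≤ 1 + 3 ^ q, just under this threshold.
  bound (q , _ , 1≤qα) = suc (suc (3 ℕ.^ q)) , λ n y d N≤n isPower isFloor → ℕ.≰⇒> λ d≤2 →
    ℕ.<⇒≱ N≤n (ℕ.≤-trans (power-bound-below q isPower isFloor
      (eventually-≤ {fromℕ 1} {fromℕ q * α} (eventually-map (λ k → subst₂ ℚ._≤_ (trans (sym ι-1) (ι-def 1)) (cong (ℚ._* seq α k) (ι-def q))) 1≤qα)))
      (ℕ.s≤s (ℕ.^-monoˡ-≤ q (ℕ.s≤s d≤2))))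

-- From α + δ ≤ 1 and 1 ≤ (p + 1) δ follows (p + 1) α ≤ p, so p / (p + 1) is a rational bound below
-- 1 for `α`. By `power-gap`, `n ≤ d` would then force n ≤ 2 ^ (p + 2).
degree<order : ∀ {α} → α < 1ℝ → ∃[ N ] (∀ n y d → N ℕ.≤ n → IsPower n α y → IsFloor y d → d ℕ.< n)
degree<order {α} (δ , 0<δ , α<1) = bound (archimedean 0<δ)
  where
  bound : ∃[ p ] (1ℚ ℚ.≤ ι (suc p) ℚ.* δ) → _
  bound (p , 1≤qδ) = suc (2 ℕ.^ suc (suc p)) , λ n y d N≤n isPower isFloor → ℕ.≰⇒> (impossible n y d N≤n isPower isFloor)
    where
    qα≤p : fromℕ (suc p) * α ≤ fromℕ p
    qα≤p = eventually-≤ {fromℕ (suc p) * α} {fromℕ p} (eventually-map (λ k α+δ≤1 → subst₂ ℚ._≤_ (cong (ℚ._* seq α k) (ι-def (suc p))) (ι-def p)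
      (subst₂ ℚ._≤_ (solve 3 (λ q a δ → q :* (a :+ δ) :- q :* δ := q :* a) refl (ι (suc p)) (seq α k) δ)
        (trans (cong (λ q → q ℚ.* 1ℚ ℚ.- 1ℚ) (trans (ι-+ 1 p) (cong (ℚ._+ ι p) ι-1))) (solve 1 (λ p → (con 1ℚ :+ p) :* con 1ℚ :- con 1ℚ := p) refl (ι p)))
        (ℚ.+-mono-≤ (*-monoˡ (ι (suc p)) (ι-nonNeg (suc p)) α+δ≤1) (ℚ.neg-antimono-≤ 1≤qδ)))) α<1)

    impossible : ∀ n y d → 2 ℕ.^ suc (suc p) ℕ.< n → IsPower n α y → IsFloor y d → ¬ (n ℕ.≤ d)
    impossible zero    y d ()
    impossible (suc m) y d N≤n isPower isFloor n≤d = ℕ.<⇒≱ N≤n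
      (power-gap m p (ℕ.s≤s⁻¹ (ℕ.≤-trans (ℕ.s≤s (ℕ.m^n>0 2 (suc (suc p)))) N≤n)) (power-bound-above p isPower isFloor qα≤p n≤d))

-- For a term c of `c₁` one has 1 ≤ K c ≤ c / d + K c = (1 + d K) (c / d), hence c / d is at least 1
-- / (1 + d K).
ε₀≤ε : ∀ {c₁ K d x} → 1 ℕ.≤ d → Eventually (λ k → 1ℚ ℚ.≤ ι K ℚ.* seq c₁ k) →
  c₁ * (1/ℕ d) ≤ x → fromℚ (inv (suc (d ℕ.* K))) ≤ x
ε₀≤ε {c₁} {K} {suc e} {x} 1≤d 1≤Kc₁ c₁/d≤x δ 0<δ = eventually-map (λ k (1≤Kc , c/d≤x) → ℚ.≤-trans (small k 1≤Kc) c/d≤x) (eventually-× 1≤Kc₁ (c₁/d≤x δ 0<δ))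
  where
  open ℚ.≤-Reasoning
  d : ℕ
  d = suc e
  i s : ℚ
  i = inv (suc (d ℕ.* K))
  s = ι (suc (d ℕ.* K))

  small : ∀ k → 1ℚ ℚ.≤ ι K ℚ.* seq c₁ k → i ℚ.≤ seq c₁ k ℚ.* (ℤ.+ 1 ℚ./ d)
  small k 1≤Kc = begin
    i
      ≡⟨ ℚ.*-identityʳ i ⟨
    i ℚ.* 1ℚ
      ≤⟨ *-monoˡ i (inv-nonNeg (suc (d ℕ.* K))) (ℚ.≤-trans 1≤Kc (subst (ℚ._≤ c ℚ.* inv d ℚ.+ ι K ℚ.* c) (ℚ.+-identityˡ _) (ℚ.+-monoˡ-≤ (ι K ℚ.* c) 0≤c/d))) ⟩
    i ℚ.* (c ℚ.* inv d ℚ.+ ι K ℚ.* c)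
      ≡⟨ cong (λ z → i ℚ.* (c ℚ.* inv d ℚ.+ z)) (trans (sym (ℚ.*-identityˡ (ι K ℚ.* c))) (cong (ℚ._* (ι K ℚ.* c)) (sym (inv*ι 1≤d)))) ⟩
    i ℚ.* (c ℚ.* inv d ℚ.+ inv d ℚ.* ι d ℚ.* (ι K ℚ.* c))
      ≡⟨ solve 5 (λ i c j d K → i :* (c :* j :+ j :* d :* (K :* c)) := i :* (con 1ℚ :+ d :* K) :* (c :* j)) refl i c (inv d) (ι d) (ι K) ⟩
    i ℚ.* (1ℚ ℚ.+ ι d ℚ.* ι K) ℚ.* (c ℚ.* inv d)
      ≡⟨ cong (λ z → i ℚ.* z ℚ.* (c ℚ.* inv d)) (trans (ι-+ 1 (d ℕ.* K)) (cong₂ ℚ._+_ ι-1 (ι-* d K))) ⟨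
    i ℚ.* s ℚ.* (c ℚ.* inv d)
      ≡⟨ trans (cong (ℚ._* (c ℚ.* inv d)) (inv*ι {suc (d ℕ.* K)} (ℕ.s≤s ℕ.z≤n))) (ℚ.*-identityˡ _) ⟩
    c ℚ.* inv d
      ≡⟨ cong (c ℚ.*_) (inv-def e) ⟩
    c ℚ.* (ℤ.+ 1 ℚ./ d) ∎
    where
    c : ℚ
    c = seq c₁ k
    0≤c : 0ℚ ℚ.≤ c
    0≤c = ℚ.≮⇒≥ λ c<0 → ℚ.<-irrefl refl (ℚ.<-≤-trans 0<1 (ℚ.≤-trans 1≤Kc
      (subst (ι K ℚ.* c ℚ.≤_) (ℚ.*-zeroʳ (ι K)) (*-monoˡ (ι K) (ι-nonNeg K) (ℚ.<⇒≤ c<0)))))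
    0≤c/d : 0ℚ ℚ.≤ c ℚ.* inv d
    0≤c/d = *-nonNeg 0≤c (inv-nonNeg d)

-- Assembly of the graph, the strategy and the constants.

HasBoostableGraph : ℕ → ℝ → ℕ → ℝ → ℝ → Set
HasBoostableGraph n nᵅ d ε c =
  ∃[ G ] (Connected {n} G × Regular G d ×
    (∀ (v : Fin n) →
      ∃[ B ] (IsStochastic B × SupportedOnEdges G B ×
        ∃[ π ] (IsTheStationaryDistribution (biasedWalk G ε B) π × (c ≤ π v * nᵅ)))))

boosting : ∀ {n d K} {y ε : ℝ} → 1 ℕ.≤ K → 1 ℕ.≤ d → BlockPath d n → fromℕ d ≤ y →
  fromℚ (inv (suc (d ℕ.* K))) ≤ ε → HasBoostableGraph n y d ε (fromℚ (inv (12 ℕ.* K ℕ.+ 6)))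
boosting {n} {d} {K} {y} {ε} 1≤K 1≤d path d≤y ε₀≤ε = graph , connected , regular , λ v →
  StationaryDistribution.Strategy.boost {n} {graph} {d} {K} {v} connected regular 1≤d (conductances path K 1≤d 1≤K v) ε ε₀≤ε {y} d≤y
  where open BlockPath path

proposition4p10 : ∀ (α : ℝ) → 0ℝ < α → α < 1ℝ →
    ∀ (c₁ c₂ : ℝ) → 0ℝ < c₁ → 0ℝ < c₂ →
    ∃[ c ] (0ℝ < c ×
    (∀ (ε : ℕ → ℝ) →
    (∃[ n₀ ] (∀ n nᵅ d → n₀ ℕ.≤ n → IsPower n α nᵅ → IsFloor nᵅ d →
    (c₁ * (1/ℕ d) ≤ ε n) × (ε n ≤ c₂ * (1/ℕ d)))) →
    ∃[ N ] (∀ n nᵅ d → N ℕ.≤ n → IsPower n α nᵅ → IsFloor nᵅ d →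
    2 ∣ (d ℕ.* n) →
    ∃[ G ] (Connected {n} G × Regular G d ×
    (∀ (v : Fin n) →
    ∃[ B ] (IsStochastic B × SupportedOnEdges G B ×
    ∃[ π ] (IsTheStationaryDistribution (biasedWalk G (ε n) B) π ×
    (c ≤ π v * nᵅ))))))))
proposition4p10 α 0<α α<1 c₁ c₂ 0<c₁ _ = main (positive⇒≥1/q c₁ 0<c₁) (degree≥3 {α} 0<α) (degree<order {α} α<1)
  where
  main : ∃[ K ] (1 ℕ.≤ K × Eventually (λ k → 1ℚ ℚ.≤ ι K ℚ.* seq c₁ k)) →
    ∃[ N₁ ] (∀ n y d → N₁ ℕ.≤ n → IsPower n α y → IsFloor y d → 3 ℕ.≤ d) →
    ∃[ N₂ ] (∀ n y d → N₂ ℕ.≤ n → IsPower n α y → IsFloor y d → d ℕ.< n) → _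
  main (K , 1≤K , 1≤Kc₁) (N₁ , d≥3) (N₂ , d<n) =
    -- The constant 1 / (12 K + 6) comes from `c₁` through `K`, before ε and `n` are given. Its half
    -- is the rational gap that a strict inequality of reals requires.
    fromℚ c , (½ ℚ.* c , positive-* 0<½ 0<c , 0 , λ _ _ → half≤) , λ ε (n₀ , ε-bounds) →
      n₀ ℕ.⊔ (N₁ ℕ.⊔ N₂) , λ n nᵅ d N≤n isPower isFloor 2∣dn →
        let n₀≤n = ℕ.m⊔n≤o⇒m≤o n₀ (N₁ ℕ.⊔ N₂) N≤n
            N₁₂≤n = ℕ.m⊔n≤o⇒n≤o n₀ (N₁ ℕ.⊔ N₂) N≤n
            3≤d = d≥3 n nᵅ d (ℕ.m⊔n≤o⇒m≤o N₁ N₂ N₁₂≤n) isPower isFloor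
            1≤d = ℕ.≤-trans (ℕ.s≤s ℕ.z≤n) 3≤d
        in boosting {y = nᵅ} {ε n} 1≤K 1≤d
             (blockPath d n 3≤d (d<n n nᵅ d (ℕ.m⊔n≤o⇒n≤o N₁ N₂ N₁₂≤n) isPower isFloor) 2∣dn)
             (isFloor .proj₁)
             (ε₀≤ε {c₁} {K} {d} {ε n} 1≤d 1≤Kc₁ (ε-bounds n nᵅ d n₀≤n isPower isFloor .proj₁))
    where
    c : ℚ
    c = inv (12 ℕ.* K ℕ.+ 6)
    0<c : 0ℚ ℚ.< c
    0<c = inv-pos (ℕ.≤-trans (ℕ.s≤s ℕ.z≤n) (ℕ.m≤n+m 6 (12 ℕ.* K)))
    half≤ : 0ℚ ℚ.+ ½ ℚ.* c ℚ.≤ c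
    half≤ = subst (ℚ._≤ c) (sym (ℚ.+-identityˡ (½ ℚ.* c))) (ℚ.<⇒≤ (half-< 0<c))
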